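{- The class of $(P_1+\overline{2P_1+P_2})$-free chordal graphs has bounded clique-width.
   Context: All graphs are finite, simple and undirected. $G$ is $H$-free if it has no induced subgraph isomorphic to $H$. A graph is chordal if it contains no induced cycle $C_r$ with $r\geq 4$. $P_r$ is the path on $r$ vertices, $+$ denotes disjoint union and $\overline{G}$ the complement; $\overline{2P_1+P_2}$ is the diamond ($K_4$ minus one edge), so $P_1+\overline{2P_1+P_2}$ is the disjoint union of an isolated vertex and a diamond. The clique-width of a graph $G$ is the minimum number $k$ of labels needed to construct $G$ using the operations: create a single vertex with label $i$; take the disjoint union of two labelled graphs; add all edges between vertices of label $i$ and vertices of label $j$ ($i\neq j$); rename label $i$ to $j$. A class of graphs has bounded clique-width if there is a constant $c$ such that every graph in the class has clique-width at most $c$. -}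

module Defs where

open import Data.Nat as ℕ using (ℕ; zero; suc; _<_; _≡ᵇ_; _≤ᵇ_)
open import Data.Fin as Fin using (Fin; toℕ; splitAt)
open import Data.Fin.Properties using (_≟_)
open import Data.Bool using (Bool; true; false; not; _∧_; _∨_; if_then_else_)
open import Data.Bool.Properties using (∨-comm)
open import Data.Sum using (_⊎_; inj₁; inj₂)
open import Data.Empty using (⊥-elim)
open import Data.Product using (Σ; ∃; _×_; _,_)
open import Relation.Nullary using (¬_; yes; no; Dec)
open import Relation.Nullary.Decidable using (⌊_⌋)
open import Relation.Binary.PropositionalEquality using (_≡_; _≢_; refl; cong; cong₂; sym)
open import Function.Definitions using (Injective)
open import Function.Bundles using (_↔_; Inverse)

record Graph : Set where
  field
    n   : ℕ
    E   : Fin n → Fin n → Bool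
    E-sym : ∀ i j → E i j ≡ E j i
    E-irr : ∀ i → E i i ≡ false
open Graph public

private
  ≟-sym : ∀ {m} (i j : Fin m) → ⌊ i ≟ j ⌋ ≡ ⌊ j ≟ i ⌋
  ≟-sym i j with i ≟ j | j ≟ i
  ... | yes _ | yes _ = refl
  ... | no _  | no _  = refl
  ... | yes p | no q  = ⊥-elim (q (sym p))
  ... | no p  | yes q = ⊥-elim (p (sym q))

  ≟-refl : ∀ {m} (i : Fin m) → ⌊ i ≟ i ⌋ ≡ true
  ≟-refl i with i ≟ i
  ... | yes _ = refl
  ... | no p  = ⊥-elim (p refl)

mkGraph : (m : ℕ) → (Fin m → Fin m → Bool) → Graph
mkGraph m R = record
  { n   = m
  ; E   = λ i j → not ⌊ i ≟ j ⌋ ∧ (R i j ∨ R j i)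
  ; E-sym = λ i j → cong₂ _∧_ (cong not (≟-sym i j)) (∨-comm (R i j) (R j i))
  ; E-irr = λ i → irr′ i
  }
  where
  irr′ : ∀ i → not ⌊ i ≟ i ⌋ ∧ (R i i ∨ R i i) ≡ false
  irr′ i with ⌊ i ≟ i ⌋ | ≟-refl i
  ... | .true | refl = refl

P : ℕ → Graph
P r = mkGraph r (λ i j → suc (toℕ i) ≡ᵇ toℕ j)

-- Cycle C_r (meaningful as a cycle for r ≥ 3): edges {i,i+1} and {r-1,0}.
C : ℕ → Graph
C r = mkGraph r (λ i j → (suc (toℕ i) ≡ᵇ toℕ j) ∨ ((toℕ j ≡ᵇ 0) ∧ (suc (toℕ i) ≡ᵇ r)))

_⊕_ : Graph → Graph → Graph
G ⊕ H = mkGraph (n G ℕ.+ n H) R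
  where
  R : Fin (n G ℕ.+ n H) → Fin (n G ℕ.+ n H) → Bool
  R i j with splitAt (n G) i | splitAt (n G) j
  ... | inj₁ a | inj₁ b = E G a b
  ... | inj₂ a | inj₂ b = E H a b
  ... | _      | _      = false

co : Graph → Graph
co G = mkGraph (n G) (λ i j → not (E G i j))

P1+diamond : Graph
P1+diamond = P 1 ⊕ co ((P 1 ⊕ P 1) ⊕ P 2)

IsInducedSubgraph : Graph → Graph → Set
IsInducedSubgraph H G =
  Σ (Fin (n H) → Fin (n G)) λ f →
    Injective _≡_ _≡_ f × (∀ x y → E G (f x) (f y) ≡ E H x y)

Free : Graph → Graph → Set
Free H G = ¬ IsInducedSubgraph H G

Chordal : Graph → Set
Chordal G = ∀ r → 4 ℕ.≤ r → Free (C r) G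

Iso : Graph → Graph → Set
Iso G H = Σ (Fin (n G) ↔ Fin (n H)) λ φ →
  ∀ x y → E H (Inverse.to φ x) (Inverse.to φ y) ≡ E G x y

data Expr (k : ℕ) : Set where
  vertex  : Fin k → Expr k
  union   : Expr k → Expr k → Expr k
  join    : (i j : Fin k) → i ≢ j → Expr k → Expr k
  relabel : (i j : Fin k) → Expr k → Expr k

size : ∀ {k} → Expr k → ℕ
size (vertex _)      = 1
size (union a b)     = size a ℕ.+ size b
size (join _ _ _ e)  = size e
size (relabel _ _ e) = size e

label : ∀ {k} (e : Expr k) → Fin (size e) → Fin k
label (vertex i) _ = i
label (union a b) x with splitAt (size a) x
... | inj₁ y = label a y
... | inj₂ y = label b y
label (join _ _ _ e) x = label e x
label (relabel i j e) x = if ⌊ label e x ≟ i ⌋ then j else label e x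

adj : ∀ {k} (e : Expr k) → Fin (size e) → Fin (size e) → Bool
adj (vertex _) _ _ = false
adj (union a b) x y with splitAt (size a) x | splitAt (size a) y
... | inj₁ x′ | inj₁ y′ = adj a x′ y′
... | inj₂ x′ | inj₂ y′ = adj b x′ y′
... | _       | _       = false
adj (join i j _ e) x y =
  adj e x y ∨ (⌊ label e x ≟ i ⌋ ∧ ⌊ label e y ≟ j ⌋)
            ∨ (⌊ label e x ≟ j ⌋ ∧ ⌊ label e y ≟ i ⌋)
adj (relabel _ _ e) x y = adj e x y

⟦_⟧ : ∀ {k} → Expr k → Graph
⟦ e ⟧ = mkGraph (size e) (adj e)

CWAtMost : ℕ → Graph → Set
CWAtMost k G = Σ (Expr k) λ e → Iso ⟦ e ⟧ G

-- A class of graphs (given as a predicate) has bounded clique-width.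
-- Clique-width is only defined for graphs with at least one vertex.
BoundedCW : (Graph → Set) → Set
BoundedCW 𝒢 = ∃ λ c → ∀ G → 𝒢 G → 0 < n G → CWAtMost c G

{-# OPTIONS --safe #-}
module Submission where

-- Clique-width is bounded through binary trees over the vertices in which every subtree has
-- few neighbourhood types towards the rest of the graph. Deleting a vertex, or
-- complementing the edges between the classes of a 2-colouring, costs a factor two in the
-- number of types, and disjoint unions cost nothing.
--
-- Unless G is complete, it has two non-adjacent simplicial vertices q and q'. Let A be the
-- clique of their common neighbours, K and K' the rest of their closed neighbourhoods, and M
-- the set of all other vertices. If M is empty, G is covered by two cliques, and chordality
-- makes the neighbourhoods between them a chain. Otherwise, excluding P₁ + diamond
-- with isolated vertex q, q' or some w ∈ M shows that, after four deletions, no path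
-- of length at most two joins K to K' outside A; then B = K ∪ K' ∪ M is diamond-free, and each of its
-- vertices misses at most one vertex of A. After at most six more deletions the vertices of one
-- component of B miss at most one common vertex of A, so that complementing inside A and
-- between A and B leaves a disjoint union of block graphs, each with at most one extra
-- vertex. A block graph is built up from isolated, pendant and twin vertices, hence all cuts of a
-- suitable tree have rank at most one.

open import Defs
open import Data.Bool using (Bool; true; false; not; _∧_; _∨_; if_then_else_) renaming (_≟_ to _≟ᵇ_)
open import Data.Bool.Properties using (∨-comm; ∨-zeroʳ; ∨-identityʳ; ¬-not)
open import Data.Empty using (⊥; ⊥-elim)
open import Data.Fin using (Fin; zero; suc; toℕ; combine; splitAt; _↑ˡ_; _↑ʳ_) renaming (join to join⊎)
open import Data.Fin.Properties using (_≟_; any?; all?; combine-injective; splitAt-↑ˡ; splitAt-↑ʳ; join-splitAt)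
open import Data.List using (List; []; _∷_; length; allFin; cartesianProduct)
open import Data.List.Membership.Propositional.Properties using (∈-allFin; ∈-cartesianProduct⁺)
open import Data.List.Relation.Unary.Any using (here; there)
open import Data.Nat using (ℕ; zero; suc; _≡ᵇ_; _+_; _*_; _^_; _≤_; _<_; z≤n; s≤s)
open import Data.Nat.Induction using (<-wellFounded)
open import Data.Product using (Σ; ∃; ∃-syntax; _×_; _,_; proj₁; proj₂)
open import Data.Sum using (_⊎_; inj₁; inj₂; [_,_]′)
open import Data.Vec using (Vec; []; _∷_; replicate)
open import Function using (_∘_; id)
open import Function.Bundles using (mk↔ₛ′)
open import Induction.WellFounded using (Acc; acc)
open import Relation.Nullary using (¬_; Dec; yes; no; does)
open import Relation.Nullary.Decidable using (⌊_⌋; _×-dec_; _⊎-dec_; _→-dec_; ¬?)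
open import Relation.Unary using (Decidable)
open import Relation.Binary.PropositionalEquality using (_≡_; _≢_; refl; sym; trans; cong; cong₂; subst)
open import Data.List.Membership.Propositional using () renaming (_∈_ to _∈ₗ_)

import Data.Nat.Properties as ℕₚ

-- The working notion is a bound on types, not on expressions, because one more bit per vertex
-- absorbs a deletion or a complementation, whereas an expression would have to be rebuilt. The
-- exponent 13 is a sum: one bit for the rank-one cuts of block graphs, one for the extra vertex of
-- each piece, one for undoing the complementation, then six and four for the two rounds of
-- deletions. The factor 3 in the number of labels is the room that a tree node needs for both
-- children and for the new types at once. The obstacle is the clique `A`, which may be large and
-- almost complete to everything else. Only its few non-edges carry information, and complementation
-- turns these into the edges that connect pieces. Chordality is invoked directly at a single place,
-- `no-cone`; every other consequence passes through it.

private variable m k : ℕ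

-- Booleans and decidable propositions

true≢false : ∀ {b} → b ≡ true → b ≡ false → ⊥
true≢false refl ()

dichotomy : ∀ b → b ≡ true ⊎ b ≡ false
dichotomy true  = inj₁ refl
dichotomy false = inj₂ refl

≡true? : ∀ b → Dec (b ≡ true)
≡true? true  = yes refl
≡true? false = no λ ()

≡false? : ∀ b → Dec (b ≡ false)
≡false? false = yes refl
≡false? true  = no λ ()

bool-ext : ∀ {a b} → (a ≡ true → b ≡ true) → (b ≡ true → a ≡ true) → a ≡ b
bool-ext {true}  f g = sym (f refl)
bool-ext {false} {true}  f g = g refl
bool-ext {false} {false} f g = refl

not-true⇒ : ∀ {b} → not b ≡ true → b ≡ false
not-true⇒ {false} _ = refl

∨-elim : ∀ {a b} → a ∨ b ≡ true → a ≡ true ⊎ b ≡ true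
∨-elim {true}  p = inj₁ refl
∨-elim {false} p = inj₂ p

∨-introˡ : ∀ {a b} → a ≡ true → a ∨ b ≡ true
∨-introˡ refl = refl

∨-introʳ : ∀ {a b} → b ≡ true → a ∨ b ≡ true
∨-introʳ {true}  p = refl
∨-introʳ {false} p = p

∧-elim : ∀ {a b} → a ∧ b ≡ true → a ≡ true × b ≡ true
∧-elim {true} {true} p = refl , refl

∧-intro : ∀ {a b} → a ≡ true → b ≡ true → a ∧ b ≡ true
∧-intro refl refl = refl

does-elim : ∀ {p} {A : Set p} (a? : Dec A) → does a? ≡ true → A
does-elim (yes a) _ = a

does-intro : ∀ {p} {A : Set p} (a? : Dec A) → A → does a? ≡ true
does-intro (yes a) _ = refl
does-intro (no ¬a) a = ⊥-elim (¬a a)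

does-false-elim : ∀ {p} {A : Set p} (a? : Dec A) → does a? ≡ false → ¬ A
does-false-elim (no ¬a) _ = ¬a

does-false-intro : ∀ {p} {A : Set p} (a? : Dec A) → ¬ A → does a? ≡ false
does-false-intro (yes a) ¬a = ⊥-elim (¬a a)
does-false-intro (no _)  _  = refl

⌊⌋-true : ∀ {p} {A : Set p} (a? : Dec A) → A → ⌊ a? ⌋ ≡ true
⌊⌋-true (yes a) _ = refl
⌊⌋-true (no ¬a) a = ⊥-elim (¬a a)

⌊⌋-false : ∀ {p} {A : Set p} (a? : Dec A) → ¬ A → ⌊ a? ⌋ ≡ false
⌊⌋-false (yes a) ¬a = ⊥-elim (¬a a)
⌊⌋-false (no _)  _  = refl

⌊⌋-elim : ∀ {p} {A : Set p} (a? : Dec A) → ⌊ a? ⌋ ≡ true → A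
⌊⌋-elim (yes a) _ = a

-- Finite sets of vertices

Sub : ℕ → Set
Sub m = Fin m → Bool

infix 4 _∈_ _∉_ _⊆_
_∈_ _∉_ : Fin m → Sub m → Set
v ∈ X = X v ≡ true
v ∉ X = X v ≡ false

_⊆_ : Sub m → Sub m → Set
X ⊆ Y = ∀ v → v ∈ X → v ∈ Y

infixl 6 _∪_ _─_
_∪_ : Sub m → Sub m → Sub m
(X ∪ Y) v = X v ∨ Y v

_─_ : Sub m → Fin m → Sub m
(X ─ x) v = X v ∧ not (does (v ≟ x))

⟪_⟫ : ∀ {P : Fin m → Set} → Decidable P → Sub m
⟪ P? ⟫ v = does (P? v)

⟨_⟩ : Fin m → Sub m
⟨ v ⟩ u = does (u ≟ v)

⟨⟩-self : (v : Fin m) → v ∈ ⟨ v ⟩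
⟨⟩-self v = does-intro (v ≟ v) refl

⟨⟩-elim : {v u : Fin m} → u ∈ ⟨ v ⟩ → u ≡ v
⟨⟩-elim {v = v} {u} = does-elim (u ≟ v)

∈─ : ∀ {X : Sub m} {x v} → v ∈ X → v ≢ x → v ∈ X ─ x
∈─ {x = x} {v} v∈ v≢ = ∧-intro v∈ (cong not (does-false-intro (v ≟ x) v≢))

∈─-elim : ∀ {X : Sub m} {x v} → v ∈ X ─ x → v ∈ X × v ≢ x
∈─-elim {X = X} {x} {v} p with ∧-elim {X v} p
... | q , r = q , does-false-elim (v ≟ x) (not-true⇒ r)

count : Sub m → ℕ
count {zero}  X = 0
count {suc m} X = (if X zero then 1 else 0) + count (X ∘ suc)

count-⊆ : (X Y : Sub m) → X ⊆ Y → count X ≤ count Y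
count-⊆ {zero}  X Y X⊆Y = z≤n
count-⊆ {suc m} X Y X⊆Y = ℕₚ.+-mono-≤ first (count-⊆ (X ∘ suc) (Y ∘ suc) (X⊆Y ∘ suc))
  where
  first : (if X zero then 1 else 0) ≤ (if Y zero then 1 else 0)
  first with X zero in eq
  ... | false = z≤n
  ... | true rewrite X⊆Y zero eq = ℕₚ.≤-refl

count-⊂ : (X Y : Sub m) → X ⊆ Y → ∀ v → v ∈ Y → v ∉ X → count X < count Y
count-⊂ X Y X⊆Y zero v∈ v∉ rewrite v∈ | v∉ = s≤s (count-⊆ (X ∘ suc) (Y ∘ suc) (X⊆Y ∘ suc))
count-⊂ X Y X⊆Y (suc v) v∈ v∉ with X zero in eq
... | true rewrite X⊆Y zero eq = s≤s (count-⊂ (X ∘ suc) (Y ∘ suc) (X⊆Y ∘ suc) v v∈ v∉)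
... | false = ℕₚ.<-≤-trans (count-⊂ (X ∘ suc) (Y ∘ suc) (X⊆Y ∘ suc) v v∈ v∉) (ℕₚ.m≤n+m _ _)

count-─ : (X : Sub m) → ∀ {x} → x ∈ X → count (X ─ x) < count X
count-─ X {x} x∈ = count-⊂ (X ─ x) X (λ _ → proj₁ ∘ ∈─-elim {X = X}) x x∈
  (¬-not λ x∈─ → proj₂ (∈─-elim {X = X} x∈─) refl)

-- Tree decompositions of vertex sets

Adj : ℕ → Set
Adj m = Fin m → Fin m → Bool

data W {m : ℕ} (L : Sub m → Set) : Sub m → Set where
  nil  : ∀ {X} → (∀ v → v ∉ X) → W L X
  leaf : ∀ {X} → L X → ∀ v → v ∈ X → (∀ u → u ∈ X → u ≡ v) → W L X
  node : ∀ {X Y Z} → L X → W L Y → W L Z → (∀ v → X v ≡ Y v ∨ Z v) →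
         (∀ v → v ∈ Y → v ∈ Z → ⊥) → W L X

W-map : ∀ {L L' : Sub m → Set} {X} → (∀ Y → Y ⊆ X → L Y → L' Y) → W L X → W L' X
W-map f (nil ∉X)       = nil ∉X
W-map f (leaf l v p q) = leaf (f _ (λ _ → id) l) v p q
W-map f (node l s t eq d) =
  node (f _ (λ _ → id) l)
       (W-map (λ Z Z⊆ → f Z (λ v p → trans (eq v) (∨-introˡ (Z⊆ v p)))) s)
       (W-map (λ Z Z⊆ → f Z (λ v p → trans (eq v) (∨-introʳ (Z⊆ v p)))) t) eq d

W-cong : ∀ {L : Sub m → Set} {X Y} → (∀ v → X v ≡ Y v) → (L X → L Y) → W L X → W L Y
W-cong eq f (nil ∉X)         = nil λ v → trans (sym (eq v)) (∉X v)
W-cong eq f (leaf l v p q)   = leaf (f l) v (trans (sym (eq v)) p) (λ u r → q u (trans (eq u) r))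
W-cong eq f (node l s t e d) = node (f l) s t (λ v → trans (sym (eq v)) (e v)) d

-- At most 2^k neighbourhood types of vertices of X towards U ∖ X.
Lab : (k : ℕ) (R : Adj m) (U X : Sub m) → Set
Lab {m} k R U X = Σ (Fin m → Vec Bool k) λ ℓ → ∀ u v → u ∈ X → v ∈ X → ℓ u ≡ ℓ v →
  ∀ w → w ∈ U → w ∉ X → R u w ≡ R v w

Width : (k : ℕ) (R : Adj m) (U : Sub m) → Set
Width k R U = W (Lab k R U) U

∷-inj : ∀ {a b} {u v : Vec Bool k} → a ∷ u ≡ b ∷ v → a ≡ b × u ≡ v
∷-inj refl = refl , refl

Lab-all : ∀ {R : Adj m} {U X} → U ⊆ X → Lab k R U X
Lab-all {k = k} U⊆X =
  (λ _ → replicate k true) , λ _ _ _ _ _ w w∈ w∉ → ⊥-elim (true≢false (U⊆X w w∈) w∉)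

Lab-one : ∀ {R : Adj m} {U X} → ∀ v → (∀ u → u ∈ X → u ≡ v) → Lab k R U X
Lab-one {k = k} {R = R} v uniq =
  (λ _ → replicate k true) , λ a b a∈ b∈ _ w _ _ → cong (λ z → R z w) (trans (uniq a a∈) (sym (uniq b b∈)))

Lab-⊆ : ∀ {R : Adj m} {U U' X} → U ⊆ U' → Lab k R U' X → Lab k R U X
Lab-⊆ U⊆ (ℓ , p) = ℓ , λ u v u∈ v∈ e w w∈ → p u v u∈ v∈ e w (U⊆ w w∈)

Lab-color : ∀ {R R' : Adj m} {U X} (c : Fin m → Bool) →
  (∀ u v w → u ∈ X → v ∈ X → w ∈ U → w ∉ X → c u ≡ c v → R u w ≡ R v w → R' u w ≡ R' v w) →
  Lab k R U X → Lab (suc k) R' U X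
Lab-color c h (ℓ , p) = (λ v → c v ∷ ℓ v) , λ u v u∈ v∈ e w w∈ w∉ →
  let e₁ , e₂ = ∷-inj e in h u v w u∈ v∈ w∈ w∉ e₁ (p u v u∈ v∈ e₂ w w∈ w∉)

-- The colour is stored as one more bit of the type. Complementing between colour classes fits the
-- hypothesis: whether the pair `u`, `w` is flipped depends only on the two colours, so vertices of
-- equal colour and equal `R`-row get equal `R'`-rows.
Width-color : ∀ {R R' : Adj m} {U} (c : Fin m → Bool) →
  (∀ u v w → u ≢ w → v ≢ w → u ∈ U → v ∈ U → w ∈ U → c u ≡ c v → R u w ≡ R v w → R' u w ≡ R' v w) →
  Width k R U → Width (suc k) R' U
Width-color c h = W-map λ Y Y⊆ → Lab-color c λ u v w u∈ v∈ w∈ w∉ →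
  h u v w (λ { refl → true≢false u∈ w∉ }) (λ { refl → true≢false v∈ w∉ }) (Y⊆ u u∈) (Y⊆ v v∈) w∈

Width-suc : ∀ {R : Adj m} {U} → Width k R U → Width (suc k) R U
Width-suc = Width-color (λ _ → true) λ _ _ _ _ _ _ _ _ _ e → e

Width-cong : ∀ {R : Adj m} {U U'} → (∀ v → U v ≡ U' v) → Width k R U → Width k R U'
Width-cong {R = R} {U} {U'} eq t =
  W-cong eq (λ _ → Lab-all λ _ → id) (W-map (λ Y _ → Lab-⊆ {R = R} λ v p → trans (eq v) p) t)

Width-ext : ∀ {R R' : Adj m} {U} → (∀ u v → u ∈ U → v ∈ U → R u v ≡ R' u v) → Width k R U → Width k R' U
Width-ext eq = W-map λ { Y Y⊆ (ℓ , p) → ℓ , λ u v u∈ v∈ e w w∈ w∉ →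
  trans (sym (eq u w (Y⊆ u u∈) w∈)) (trans (p u v u∈ v∈ e w w∈ w∉) (eq v w (Y⊆ v v∈) w∈)) }

W-add : ∀ {L : Sub m → Set} {U x} → x ∈ U → L U → L ⟨ x ⟩ → W L (U ─ x) → W L U
W-add {U = U} {x} x∈ lU lx t = node lU t (leaf lx x (⟨⟩-self x) (λ _ → ⟨⟩-elim))
  eq (λ v p q → proj₂ (∈─-elim {X = U} p) (⟨⟩-elim q))
  where
  eq : ∀ v → U v ≡ (U ─ x) v ∨ ⟨ x ⟩ v
  eq v with v ≟ x
  ... | yes refl = trans x∈ (sym (∨-zeroʳ _))
  ... | no _ with U v
  ...   | true  = refl
  ...   | false = refl

-- The vertex `x` becomes a leaf below a new root. The old tree ignores just one column, that of
-- `x`, and the new bit `R v x` of the type records it.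
Width-delete : ∀ {R : Adj m} {U} x → Width k R (U ─ x) → Width (suc k) R U
Width-delete {R = R} {U} x t with dichotomy (U x)
... | inj₂ x∉ = Width-suc (Width-cong eq t)
  where
  eq : ∀ v → (U ─ x) v ≡ U v
  eq v = bool-ext (proj₁ ∘ ∈─-elim {X = U}) λ v∈ → ∈─ {X = U} v∈ λ { refl → true≢false v∈ x∉ }
... | inj₁ x∈ = W-add x∈ (Lab-all λ _ → id) (Lab-one x λ _ → ⟨⟩-elim) (W-map (λ Y Y⊆ → lift Y) t)
  where
  lift : ∀ Y → Lab _ R (U ─ x) Y → Lab _ R U Y
  lift Y (ℓ , p) = (λ v → R v x ∷ ℓ v) , go
    where
    go : ∀ u v → u ∈ Y → v ∈ Y → R u x ∷ ℓ u ≡ R v x ∷ ℓ v → ∀ w → w ∈ U → w ∉ Y → R u w ≡ R v w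
    go u v u∈ v∈ e w w∈ w∉ with w ≟ x
    ... | yes refl = proj₁ (∷-inj e)
    ... | no w≢x   = p u v u∈ v∈ (proj₂ (∷-inj e)) w (∈─ {X = U} w∈ w≢x) w∉

-- Several deletions, and disjoint unions

infixl 7 _∖_
_∖_ : Sub m → List (Fin m) → Sub m
X ∖ []      = X
X ∖ (x ∷ l) = (X ─ x) ∖ l

∈∖-elim : ∀ {X : Sub m} l {v} → v ∈ X ∖ l → v ∈ X × (∀ x → x ∈ₗ l → v ≢ x)
∈∖-elim []      v∈ = v∈ , λ _ ()
∈∖-elim {X = X} (x ∷ l) {v} v∈ with ∈∖-elim l v∈
... | v∈─ , ne with ∈─-elim {X = X} v∈─
...   | v∈X , v≢x = v∈X , λ { _ (here refl) → v≢x ; y (there y∈) → ne y y∈ }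

∈∖ : ∀ {X : Sub m} l {v} → v ∈ X → (∀ x → x ∈ₗ l → v ≢ x) → v ∈ X ∖ l
∈∖ [] v∈ _ = v∈
∈∖ {X = X} (x ∷ l) v∈ ne = ∈∖ l (∈─ {X = X} v∈ (ne x (here refl))) λ y y∈ → ne y (there y∈)

∖-∪ : ∀ (X Y : Sub m) l v → (X ∖ l ∪ Y ∖ l) v ≡ ((X ∪ Y) ∖ l) v
∖-∪ X Y l v = bool-ext
  (λ p → [ (λ a → let a∈ , ne = ∈∖-elim {X = X} l a in ∈∖ {X = X ∪ Y} l (∨-introˡ a∈) ne)
         , (λ b → let b∈ , ne = ∈∖-elim {X = Y} l b in ∈∖ {X = X ∪ Y} l (∨-introʳ {X v} b∈) ne) ]′
         (∨-elim {(X ∖ l) v} p))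
  (λ p → let p∈ , ne = ∈∖-elim {X = X ∪ Y} l p in
    [ (λ a → ∨-introˡ (∈∖ {X = X} l a ne)) , (λ b → ∨-introʳ {(X ∖ l) v} (∈∖ {X = Y} l b ne)) ]′ (∨-elim {X v} p∈))

Width-deletes : ∀ {R : Adj m} {U} l → Width k R (U ∖ l) → Width (length l + k) R U
Width-deletes []      t = t
Width-deletes (x ∷ l) t = Width-delete x (Width-deletes l t)

Width-+ : ∀ {R : Adj m} {U} j → Width k R U → Width (j + k) R U
Width-+ zero    t = t
Width-+ (suc j) t = Width-suc (Width-+ j t)

-- A set inside one part sees only zeros in the other part, so its old types stay valid. The new
-- root has nothing outside it.
Width-union : ∀ {R : Adj m} {U U₁ U₂} → (∀ v → U v ≡ U₁ v ∨ U₂ v) → (∀ v → v ∈ U₁ → v ∈ U₂ → ⊥) →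
  (∀ u v → u ∈ U₁ → v ∈ U₂ → R u v ≡ false) → (∀ u v → u ∈ U₂ → v ∈ U₁ → R u v ≡ false) →
  Width k R U₁ → Width k R U₂ → Width k R U
Width-union {R = R} {U} {U₁} {U₂} eq disj n₁ n₂ t₁ t₂ =
  node (Lab-all λ _ → id) (W-map (λ Y Y⊆ → lift Y Y⊆ eq n₁) t₁)
       (W-map (λ Y Y⊆ → lift Y Y⊆ (λ v → trans (eq v) (∨-comm (U₁ v) (U₂ v))) n₂) t₂) eq disj
  where
  lift : ∀ {V₁ V₂} Y → Y ⊆ V₁ → (∀ v → U v ≡ V₁ v ∨ V₂ v) → (∀ u v → u ∈ V₁ → v ∈ V₂ → R u v ≡ false) →
         Lab _ R V₁ Y → Lab _ R U Y
  lift Y Y⊆ eq' n (ℓ , p) = ℓ , λ u v u∈ v∈ e w w∈ w∉ →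
    [ (λ w∈₁ → p u v u∈ v∈ e w w∈₁ w∉)
    , (λ w∈₂ → trans (n u w (Y⊆ u u∈) w∈₂) (sym (n v w (Y⊆ v v∈) w∈₂))) ]′
    (∨-elim (trans (sym (eq' w)) w∈))

-- Realising trees by clique-width expressions

-- `R` is compared with `adj` itself, before the symmetrisation in `⟦_⟧`. Thus the record also
-- describes the half-built relations that occur between two operations.
record Rep (K : ℕ) (R : Adj m) (X : Sub m) (l : Fin m → Fin K) : Set where
  field
    e      : Expr K
    φ      : Fin (size e) → Fin m
    φ-inj  : ∀ x y → φ x ≡ φ y → x ≡ y
    φ-in   : ∀ x → φ x ∈ X
    φ-onto : ∀ v → v ∈ X → ∃ λ x → φ x ≡ v
    adj≡   : ∀ x y → adj e x y ≡ R (φ x) (φ y)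
    label≡ : ∀ x → label e x ≡ l (φ x)

Rep-cong : ∀ {K} {R R' : Adj m} {X X' l l'} → (∀ v → X v ≡ X' v) →
  (∀ u v → u ∈ X → v ∈ X → R u v ≡ R' u v) → (∀ v → v ∈ X → l v ≡ l' v) → Rep K R X l → Rep K R' X' l'
Rep-cong eqX eqR eql r = record
  { e = e ; φ = φ ; φ-inj = φ-inj
  ; φ-in = λ x → trans (sym (eqX _)) (φ-in x)
  ; φ-onto = λ v v∈ → φ-onto v (trans (eqX v) v∈)
  ; adj≡ = λ x y → trans (adj≡ x y) (eqR _ _ (φ-in x) (φ-in y))
  ; label≡ = λ x → trans (label≡ x) (eql _ (φ-in x)) }
  where open Rep r

Rep-vertex : ∀ {K} {R : Adj m} {X} v (l : Fin m → Fin K) → v ∈ X → (∀ u → u ∈ X → u ≡ v) →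
  R v v ≡ false → Rep K R X l
Rep-vertex v l v∈ uniq irr = record
  { e = vertex (l v) ; φ = λ _ → v ; φ-inj = λ { zero zero _ → refl } ; φ-in = λ _ → v∈
  ; φ-onto = λ u u∈ → zero , sym (uniq u u∈) ; adj≡ = λ _ _ → sym irr ; label≡ = λ _ → refl }

Rep-relabel : ∀ {K} {R : Adj m} {X l} (i j : Fin K) → Rep K R X l →
  Rep K R X (λ v → if ⌊ l v ≟ i ⌋ then j else l v)
Rep-relabel i j r = record
  { e = relabel i j e ; φ = φ ; φ-inj = φ-inj ; φ-in = φ-in ; φ-onto = φ-onto ; adj≡ = adj≡
  ; label≡ = λ x → cong (λ z → if ⌊ z ≟ i ⌋ then j else z) (label≡ x) }
  where open Rep r

joinAdj : ∀ {K} → Adj m → (Fin m → Fin K) → Fin K → Fin K → Adj m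
joinAdj R l i j u v = R u v ∨ (⌊ l u ≟ i ⌋ ∧ ⌊ l v ≟ j ⌋) ∨ (⌊ l u ≟ j ⌋ ∧ ⌊ l v ≟ i ⌋)

Rep-join : ∀ {K} {R : Adj m} {X l} (i j : Fin K) → i ≢ j → Rep K R X l → Rep K (joinAdj R l i j) X l
Rep-join {R = R} {l = l} i j i≢j r = record
  { e = join i j i≢j e ; φ = φ ; φ-inj = φ-inj ; φ-in = φ-in ; φ-onto = φ-onto ; adj≡ = eq ; label≡ = label≡ }
  where
  open Rep r
  eq : ∀ x y → adj (join i j i≢j e) x y ≡ joinAdj R l i j (φ x) (φ y)
  eq x y rewrite adj≡ x y | label≡ x | label≡ y = refl

-- The parts arrive with labellings of their own, which are glued into `l`. The mask on `R` removes
-- the edges between the parts; these are added afterwards by joins.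
Rep-union : ∀ {K} {R : Adj m} {X Y Z l₁ l₂ l} → (∀ v → X v ≡ Y v ∨ Z v) → (∀ v → v ∈ Y → v ∈ Z → ⊥) →
  (∀ v → v ∈ Y → l₁ v ≡ l v) → (∀ v → v ∈ Z → l₂ v ≡ l v) →
  Rep K R Y l₁ → Rep K R Z l₂ →
  Rep K (λ u v → R u v ∧ ((Y u ∧ Y v) ∨ (Z u ∧ Z v))) X l
Rep-union {R = R} {X} {Y} {Z} {l = l} eq disj eql₁ eql₂ r₁ r₂ = record
  { e = union A.e B.e ; φ = ψ ; φ-inj = inj ; φ-in = λ x → ∈X (splitAt A.s x)
  ; φ-onto = onto ; adj≡ = adjEq ; label≡ = labelEq }
  where
  module A where
    open Rep r₁ public
    s = size e
  module B where
    open Rep r₂ public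
    s = size e
  χ : Fin A.s ⊎ Fin B.s → _
  χ = [ A.φ , B.φ ]′
  ψ : Fin (A.s + B.s) → _
  ψ x = χ (splitAt A.s x)
  ∈X : ∀ s → χ s ∈ X
  ∈X (inj₁ a) = trans (eq _) (∨-introˡ (A.φ-in a))
  ∈X (inj₂ b) = trans (eq _) (∨-introʳ (B.φ-in b))
  χ-inj : ∀ s t → χ s ≡ χ t → s ≡ t
  χ-inj (inj₁ a) (inj₁ b) p = cong inj₁ (A.φ-inj a b p)
  χ-inj (inj₂ a) (inj₂ b) p = cong inj₂ (B.φ-inj a b p)
  χ-inj (inj₁ a) (inj₂ b) p = ⊥-elim (disj _ (A.φ-in a) (subst (_∈ Z) (sym p) (B.φ-in b)))
  χ-inj (inj₂ a) (inj₁ b) p = ⊥-elim (disj _ (A.φ-in b) (subst (_∈ Z) p (B.φ-in a)))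
  inj : ∀ x y → ψ x ≡ ψ y → x ≡ y
  inj x y p = trans (sym (join-splitAt A.s B.s x))
    (trans (cong (join⊎ A.s B.s) (χ-inj (splitAt A.s x) (splitAt A.s y) p)) (join-splitAt A.s B.s y))
  onto : ∀ v → v ∈ X → ∃ λ x → ψ x ≡ v
  onto v v∈ with ∨-elim (trans (sym (eq v)) v∈)
  ... | inj₁ p = let a , q = A.φ-onto v p in a ↑ˡ B.s , trans (cong χ (splitAt-↑ˡ A.s a B.s)) q
  ... | inj₂ p = let b , q = B.φ-onto v p in A.s ↑ʳ b , trans (cong χ (splitAt-↑ʳ A.s B.s b)) q
  labelEq : ∀ x → label (union A.e B.e) x ≡ l (ψ x)
  labelEq x with splitAt A.s x
  ... | inj₁ a = trans (A.label≡ a) (eql₁ _ (A.φ-in a))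
  ... | inj₂ b = trans (B.label≡ b) (eql₂ _ (B.φ-in b))
  ∉Y : ∀ b → B.φ b ∉ Y
  ∉Y b = ¬-not λ p → disj _ p (B.φ-in b)
  ∉Z : ∀ a → A.φ a ∉ Z
  ∉Z a = ¬-not λ p → disj _ (A.φ-in a) p
  adjEq : ∀ x y → adj (union A.e B.e) x y ≡ R (ψ x) (ψ y) ∧ ((Y (ψ x) ∧ Y (ψ y)) ∨ (Z (ψ x) ∧ Z (ψ y)))
  adjEq x y with splitAt A.s x | splitAt A.s y
  ... | inj₁ a | inj₁ b rewrite A.φ-in a | A.φ-in b | A.adj≡ a b with R (A.φ a) (A.φ b)
  ...   | true  = refl
  ...   | false = refl
  adjEq x y | inj₂ a | inj₂ b rewrite B.φ-in a | B.φ-in b | ∉Y a | B.adj≡ a b with R (B.φ a) (B.φ b)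
  ...   | true  = refl
  ...   | false = refl
  adjEq x y | inj₁ a | inj₂ b rewrite ∉Y b | ∉Z a with R (A.φ a) (B.φ b) | Y (A.φ a)
  ... | true  | true  = refl
  ... | true  | false = refl
  ... | false | _     = refl
  adjEq x y | inj₂ a | inj₁ b rewrite ∉Y a | ∉Z b with R (B.φ a) (A.φ b) | Z (B.φ a)
  ... | true  | true  = refl
  ... | true  | false = refl
  ... | false | _     = refl

Rep-CW : ∀ {K} (G : Graph) {X l} → (∀ v → v ∈ X) → Rep K (E G) X l → CWAtMost K G
Rep-CW G all∈ r = e , mk↔ₛ′ φ (λ v → proj₁ (φ-onto v (all∈ v)))
    (λ v → proj₂ (φ-onto v (all∈ v))) (λ x → φ-inj _ _ (proj₂ (φ-onto _ (all∈ _)))) , eq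
  where
  open Rep r
  eq : ∀ x y → E G (φ x) (φ y) ≡ not ⌊ x ≟ y ⌋ ∧ (adj e x y ∨ adj e y x)
  eq x y with x ≟ y
  ... | yes refl = E-irr G (φ x)
  ... | no _ rewrite adj≡ x y | adj≡ y x | E-sym G (φ y) (φ x) with E G (φ x) (φ y)
  ...   | true  = refl
  ...   | false = refl

-- Neighbourhood types as labels

bit : Bool → Fin 2
bit b = if b then suc zero else zero

enc : Vec Bool k → Fin (2 ^ k)
enc []      = zero
enc (b ∷ v) = combine (bit b) (enc v)

enc-inj : (u v : Vec Bool k) → enc u ≡ enc v → u ≡ v
enc-inj [] [] _ = refl
enc-inj (a ∷ u) (b ∷ v) p with combine-injective (bit a) (enc u) (bit b) (enc v) p
enc-inj (true  ∷ u) (true  ∷ v) _ | _ , q = cong (true ∷_) (enc-inj u v q)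
enc-inj (false ∷ u) (false ∷ v) _ | _ , q = cong (false ∷_) (enc-inj u v q)
enc-inj (true  ∷ u) (false ∷ v) _ | () , _
enc-inj (false ∷ u) (true  ∷ v) _ | () , _

-- Labels are pairs of one of three banks and a neighbourhood type.
module Banks {m : ℕ} (M : ℕ) where

  Rep₃ : Adj m → Sub m → (Fin m → Fin 3) → (Fin m → Fin M) → Set
  Rep₃ R X β ℓ = Rep (3 * M) R X (λ v → combine (β v) (ℓ v))

  bank≢ : ∀ {b b' : Fin 3} {i j : Fin M} → b ≢ b' → combine b i ≢ combine b' j
  bank≢ {b} {b'} {i} {j} b≢ p = b≢ (proj₁ (combine-injective b i b' j p))

  -- Types are renamed one at a time. Since the target bank differs from the source bank, a vertex
  -- that has been moved is never caught by another renaming.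
  relabels : ∀ {R X l} {b b' : Fin 3} → b ≢ b' → (h : Fin M → Fin M) → Rep (3 * M) R X l → (is : List (Fin M)) →
    Σ (Fin m → Fin (3 * M)) λ l' → Rep (3 * M) R X l' ×
      (∀ v i → i ∈ₗ is → l v ≡ combine b i → l' v ≡ combine b' (h i)) ×
      (∀ v → (∀ i → i ∈ₗ is → l v ≢ combine b i) → l' v ≡ l v)
  relabels {l = l} b≢ h r [] = l , r , (λ _ _ ()) , (λ _ _ → refl)
  relabels {l = l} {b} {b'} b≢ h r (i ∷ is) with relabels b≢ h r is
  ... | l' , r' , p , q = l'' , Rep-relabel (combine b i) (combine b' (h i)) r' , p' , q'
    where
    l'' : Fin m → Fin (3 * M)
    l'' v = if ⌊ l' v ≟ combine b i ⌋ then combine b' (h i) else l' v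
    keep : ∀ v → l' v ≢ combine b i → l'' v ≡ l' v
    keep v ne = cong (λ z → if z then combine b' (h i) else l' v) (⌊⌋-false (l' v ≟ combine b i) ne)
    rest : ∀ v j → j ∈ₗ is → l v ≡ combine b j → l'' v ≡ combine b' (h j)
    rest v j j∈ e = trans (keep v λ e' → bank≢ b≢ (trans (sym e') (p v j j∈ e))) (p v j j∈ e)
    p' : ∀ v j → j ∈ₗ i ∷ is → l v ≡ combine b j → l'' v ≡ combine b' (h j)
    p' v j (there j∈) e = rest v j j∈ e
    p' v j (here refl) e with l' v ≟ combine b i
    ... | yes _ = refl
    -- The list may repeat `j`. If it does, the vertex has already been moved, as `p` says; if not,
    -- `q` says that it still carries its old label, against `ne`.
    ... | no ne with j ∈? is
      where open import Data.List.Membership.DecPropositional (_≟_ {M}) using (_∈?_)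
    ...   | yes j∈ = p v j j∈ e
    ...   | no j∉ = ⊥-elim (ne (trans (q v λ i' i'∈ e' → j∉ (subst (_∈ₗ is)
              (sym (proj₂ (combine-injective b j b i' (trans (sym e) e')))) i'∈)) e))
    q' : ∀ v → (∀ j → j ∈ₗ i ∷ is → l v ≢ combine b j) → l'' v ≡ l v
    q' v ne = trans (keep v λ e → ne i (here refl) (trans (sym l'≡l) e)) l'≡l
      where l'≡l = q v λ j j∈ → ne j (there j∈)

  Rep-move : ∀ {R X β ℓ} (b b' : Fin 3) → b ≢ b' → (h : Fin M → Fin M) → Rep₃ R X β ℓ →
    Rep₃ R X (λ v → if ⌊ β v ≟ b ⌋ then b' else β v) (λ v → if ⌊ β v ≟ b ⌋ then h (ℓ v) else ℓ v)
  Rep-move {β = β} {ℓ} b b' b≢ h r with relabels {b = b} {b'} b≢ h r (allFin M)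
  ... | l' , r' , p , q = Rep-cong (λ _ → refl) (λ _ _ _ _ → refl) (λ v _ → eq v) r'
    where
    eq : ∀ v → l' v ≡ combine (if ⌊ β v ≟ b ⌋ then b' else β v) (if ⌊ β v ≟ b ⌋ then h (ℓ v) else ℓ v)
    eq v with β v ≟ b
    ... | yes e = p v (ℓ v) (∈-allFin (ℓ v)) (cong (λ z → combine z (ℓ v)) e)
    ... | no ne = q v λ i _ → bank≢ ne

  joins : ∀ {R X l} {b b' : Fin 3} → b ≢ b' → (p : Fin M → Fin M → Bool) → Rep (3 * M) R X l →
    (qs : List (Fin M × Fin M)) → Σ (Adj m) λ R' → Rep (3 * M) R' X l ×
      (∀ u v → R u v ≡ true → R' u v ≡ true) ×
      (∀ u v i j → (i , j) ∈ₗ qs → p i j ≡ true → l u ≡ combine b i → l v ≡ combine b' j →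
        R' u v ≡ true × R' v u ≡ true) ×
      (∀ u v → R' u v ≡ true → R u v ≡ true ⊎ ∃[ i ] ∃[ j ] p i j ≡ true ×
        ((l u ≡ combine b i × l v ≡ combine b' j) ⊎ (l u ≡ combine b' j × l v ≡ combine b i)))
  joins {R} b≢ p r [] = R , r , (λ _ _ x → x) , (λ _ _ _ _ ()) , (λ _ _ → inj₁)
  joins {R} {l = l} {b} {b'} b≢ p r ((i , j) ∷ qs) with joins b≢ p r qs | p i j in pij
  ... | R' , r' , mono , done , snd | false = R' , r' , mono , done' , snd
    where
    done' : ∀ u v i' j' → (i' , j') ∈ₗ (i , j) ∷ qs → p i' j' ≡ true → l u ≡ combine b i' → l v ≡ combine b' j' →
      R' u v ≡ true × R' v u ≡ true
    done' u v _ _ (here refl) q = ⊥-elim (true≢false q pij)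
    done' u v _ _ (there x) q = done u v _ _ x q
  ... | R' , r' , mono , done , snd | true =
    joinAdj R' l I J , Rep-join I J (bank≢ b≢) r' , (λ u v x → ∨-introˡ (mono u v x)) , done' , snd'
    where
    I = combine b i
    J = combine b' j
    done' : ∀ u v i' j' → (i' , j') ∈ₗ (i , j) ∷ qs → p i' j' ≡ true → l u ≡ combine b i' → l v ≡ combine b' j' →
      joinAdj R' l I J u v ≡ true × joinAdj R' l I J v u ≡ true
    done' u v _ _ (here refl) q eu ev =
      ∨-introʳ {R' u v} (∨-introˡ (∧-intro (⌊⌋-true (l u ≟ I) eu) (⌊⌋-true (l v ≟ J) ev))) ,
      ∨-introʳ {R' v u} (∨-introʳ {⌊ l v ≟ I ⌋ ∧ ⌊ l u ≟ J ⌋} (∧-intro (⌊⌋-true (l v ≟ J) ev) (⌊⌋-true (l u ≟ I) eu)))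
    done' u v _ _ (there x) q eu ev with done u v _ _ x q eu ev
    ... | y , z = ∨-introˡ y , ∨-introˡ z
    snd' : ∀ u v → joinAdj R' l I J u v ≡ true → R u v ≡ true ⊎ ∃[ i ] ∃[ j ] p i j ≡ true ×
        ((l u ≡ combine b i × l v ≡ combine b' j) ⊎ (l u ≡ combine b' j × l v ≡ combine b i))
    snd' u v x with ∨-elim {R' u v} x
    ... | inj₁ y = snd u v y
    ... | inj₂ y with ∨-elim {⌊ l u ≟ I ⌋ ∧ ⌊ l v ≟ J ⌋} y
    ...   | inj₁ z = let z₁ , z₂ = ∧-elim {⌊ l u ≟ I ⌋} z in
              inj₂ (i , j , pij , inj₁ (⌊⌋-elim (l u ≟ I) z₁ , ⌊⌋-elim (l v ≟ J) z₂))
    ...   | inj₂ z = let z₁ , z₂ = ∧-elim {⌊ l u ≟ J ⌋} z in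
              inj₂ (i , j , pij , inj₂ (⌊⌋-elim (l u ≟ J) z₁ , ⌊⌋-elim (l v ≟ I) z₂))

-- From trees with few types to expressions

module Realise {m : ℕ} (k : ℕ) (R : Adj m) (R-sym : ∀ u v → R u v ≡ R v u) (R-irr : ∀ v → R v v ≡ false) (U : Sub m) where
  M : ℕ
  M = 2 ^ k
  open Banks {m} M

  Valid : Sub m → (Fin m → Fin M) → Set
  Valid X ℓ = ∀ u v → u ∈ X → v ∈ X → ℓ u ≡ ℓ v → ∀ w → w ∈ U → w ∉ X → R u w ≡ R v w

  Realised : Sub m → Set
  Realised X = Σ (Fin m → Fin M) λ ℓ → Valid X ℓ × Rep₃ R X (λ _ → zero) ℓ

  Lab⇒Valid : ∀ {X} → Lab k R U X → Σ (Fin m → Fin M) (Valid X)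
  Lab⇒Valid (ℓ , p) = enc ∘ ℓ , λ u v u∈ v∈ e → p u v u∈ v∈ (enc-inj _ _ e)

  Realised-cong : ∀ {X Y} → (∀ v → X v ≡ Y v) → Realised X → Realised Y
  Realised-cong eq (ℓ , val , r) =
    ℓ , (λ u v u∈ v∈ e w w∈ w∉ → val u v (trans (eq u) u∈) (trans (eq v) v∈) e w w∈ (trans (eq w) w∉)) ,
    Rep-cong eq (λ _ _ _ _ → refl) (λ _ _ → refl) r

  -- Types of Y are sent to types of the larger set via a representative.
  representative : (Y : Sub m) (ℓ₁ ℓ : Fin m → Fin M) → Σ (Fin M → Fin M) λ h →
    ∀ u → u ∈ Y → ∃[ u' ] u' ∈ Y × ℓ₁ u ≡ ℓ₁ u' × h (ℓ₁ u) ≡ ℓ u'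
  representative Y ℓ₁ ℓ = h , spec
    where
    d : ∀ i → Dec (∃[ u ] u ∈ Y × i ≡ ℓ₁ u)
    d i = any? λ u → ≡true? (Y u) ×-dec (i ≟ ℓ₁ u)
    h : Fin M → Fin M
    h i with d i
    ... | yes (u , _) = ℓ u
    ... | no _        = i
    spec : ∀ u → u ∈ Y → ∃[ u' ] u' ∈ Y × ℓ₁ u ≡ ℓ₁ u' × h (ℓ₁ u) ≡ ℓ u'
    spec u u∈ with d (ℓ₁ u)
    ... | yes (u' , u'∈ , e) = u' , u'∈ , e , refl
    ... | no ¬p = ⊥-elim (¬p (u , u∈ , refl))

  realise-node : ∀ {X Y Z} → X ⊆ U → Lab k R U X → (∀ v → X v ≡ Y v ∨ Z v) → (∀ v → v ∈ Y → v ∈ Z → ⊥) →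
    Realised Y → Realised Z → Realised X
  realise-node {X} {Y} {Z} X⊆U lab eq disj (ℓ₁ , val₁ , r₁) (ℓ₂ , val₂ , r₂) = ℓ' , val' , r-final
    where
    ℓ : Fin m → Fin M
    ℓ = proj₁ (Lab⇒Valid lab)
    val : Valid X ℓ
    val = proj₂ (Lab⇒Valid lab)
    h₁ = proj₁ (representative Y ℓ₁ ℓ)
    h₂ = proj₁ (representative Z ℓ₂ ℓ)
    ℓ' : Fin m → Fin M
    ℓ' v = if Y v then h₁ (ℓ₁ v) else h₂ (ℓ₂ v)
    Y⊆X : Y ⊆ X
    Y⊆X v p = trans (eq v) (∨-introˡ p)
    Z⊆X : Z ⊆ X
    Z⊆X v p = trans (eq v) (∨-introʳ p)
    Z⇒∉Y : ∀ v → v ∈ Z → v ∉ Y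
    Z⇒∉Y v p = ¬-not λ q → disj v q p
    Y⇒∉Z : ∀ v → v ∈ Y → v ∉ Z
    Y⇒∉Z v p = ¬-not λ q → disj v p q
    X⇒ : ∀ v → v ∈ X → v ∈ Y ⊎ v ∈ Z
    X⇒ v p = ∨-elim (trans (sym (eq v)) p)
    ∉Y : ∀ w → w ∉ X → w ∉ Y
    ∉Y w p = ¬-not λ q → true≢false (Y⊆X w q) p
    ∉Z : ∀ w → w ∉ X → w ∉ Z
    ∉Z w p = ¬-not λ q → true≢false (Z⊆X w q) p

    -- Relabelling acts on whole types of a child, so `ℓ'` need not coincide with `ℓ`. Each vertex
    -- is therefore compared with the representative of its type, which has the same row outside
    -- `X`.
    rep : ∀ u → u ∈ X → ∃[ u' ] u' ∈ X × ℓ' u ≡ ℓ u' × (∀ w → w ∈ U → w ∉ X → R u w ≡ R u' w)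
    rep u u∈ with X⇒ u u∈
    ... | inj₁ p rewrite p with proj₂ (representative Y ℓ₁ ℓ) u p
    ...   | u' , u'∈ , e , e' = u' , Y⊆X u' u'∈ , e' , λ w w∈ w∉ → val₁ u u' p u'∈ e w w∈ (∉Y w w∉)
    rep u u∈ | inj₂ p rewrite Z⇒∉Y u p with proj₂ (representative Z ℓ₂ ℓ) u p
    ...   | u' , u'∈ , e , e' = u' , Z⊆X u' u'∈ , e' , λ w w∈ w∉ → val₂ u u' p u'∈ e w w∈ (∉Z w w∉)

    val' : Valid X ℓ'
    val' u v u∈ v∈ e w w∈ w∉ with rep u u∈ | rep v v∈
    ... | u' , u'∈ , eu , ru | v' , v'∈ , ev , rv =
      trans (ru w w∈ w∉) (trans (val u' v' u'∈ v'∈ (trans (sym eu) (trans e ev)) w w∈ w∉) (sym (rv w w∈ w∉)))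

    β₀ : Fin m → Fin 3
    β₀ v = if Y v then zero else suc zero
    ℓ₀ : Fin m → Fin M
    ℓ₀ v = if Y v then ℓ₁ v else ℓ₂ v
    R₀ : Adj m
    R₀ u v = R u v ∧ ((Y u ∧ Y v) ∨ (Z u ∧ Z v))
    inY : ∀ v → v ∈ Y → combine {3} zero (ℓ₁ v) ≡ combine (β₀ v) (ℓ₀ v)
    inY v p rewrite p = refl
    inZ : ∀ v → v ∈ Z → combine {3} (suc zero) (ℓ₂ v) ≡ combine (β₀ v) (ℓ₀ v)
    inZ v p rewrite Z⇒∉Y v p = refl

    r-union : Rep₃ R₀ X β₀ ℓ₀
    r-union = Rep-union {R = R} eq disj inY inZ r₁
      (Rep-move {β = λ _ → zero} {ℓ = ℓ₂} zero (suc zero) (λ ()) id r₂)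

    cross? : ∀ i j → Dec (∃[ u ] ∃[ v ] u ∈ Y × v ∈ Z × i ≡ ℓ₁ u × j ≡ ℓ₂ v × R u v ≡ true)
    cross? i j = any? λ u → any? λ v →
      ≡true? (Y u) ×-dec ≡true? (Z v) ×-dec (i ≟ ℓ₁ u) ×-dec (j ≟ ℓ₂ v) ×-dec ≡true? (R u v)
    p : Fin M → Fin M → Bool
    p i j = does (cross? i j)
    qs : List (Fin M × Fin M)
    qs = cartesianProduct (allFin M) (allFin M)
    joined = joins {R = R₀} {b = zero} {suc zero} (λ ()) p r-union qs
    R₁ = proj₁ joined

    -- One adjacent pair of the given types decides for all such pairs: `u` may be replaced by `u'`
    -- because `v` lies outside `Y`, and then `v` by `v'` because `u'` lies outside `Z`.
    p⇒R : ∀ u v → u ∈ Y → v ∈ Z → p (ℓ₁ u) (ℓ₂ v) ≡ true → R u v ≡ true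
    p⇒R u v u∈ v∈ q with does-elim (cross? (ℓ₁ u) (ℓ₂ v)) q
    ... | u' , v' , u'∈ , v'∈ , eu , ev , r =
      trans (val₁ u u' u∈ u'∈ eu v (X⊆U v (Z⊆X v v∈)) (Z⇒∉Y v v∈))
        (trans (R-sym u' v) (trans (val₂ v v' v∈ v'∈ ev u' (X⊆U u' (Y⊆X u' u'∈)) (Y⇒∉Z u' u'∈))
          (trans (R-sym v' u') r)))

    β-zero : ∀ v {i : Fin M} → combine (β₀ v) (ℓ₀ v) ≡ combine {3} zero i → v ∈ Y × i ≡ ℓ₁ v
    β-zero v {i} e with combine-injective (β₀ v) (ℓ₀ v) zero i e
    ... | e₁ , e₂ with Y v
    ...   | true  = refl , sym e₂
    β-zero v {i} e | () , e₂ | false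
    β-one : ∀ v {i : Fin M} → v ∈ X → combine (β₀ v) (ℓ₀ v) ≡ combine {3} (suc zero) i → v ∈ Z × i ≡ ℓ₂ v
    β-one v {i} v∈ e with combine-injective (β₀ v) (ℓ₀ v) (suc zero) i e
    ... | e₁ , e₂ with X⇒ v v∈
    ...   | inj₂ v∈Z rewrite Z⇒∉Y v v∈Z = v∈Z , sym e₂
    ...   | inj₁ v∈Y rewrite v∈Y with e₁
    ...     | ()

    R₁≡R : ∀ u v → u ∈ X → v ∈ X → R₁ u v ≡ R u v
    R₁≡R u v u∈ v∈ = bool-ext to from
      where
      to : R₁ u v ≡ true → R u v ≡ true
      to x with proj₂ (proj₂ (proj₂ (proj₂ joined))) u v x
      ... | inj₁ y = proj₁ (∧-elim {R u v} y)
      ... | inj₂ (i , j , q , inj₁ (eu , ev)) with β-zero u eu | β-one v v∈ ev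
      ...   | u∈Y , refl | v∈Z , refl = p⇒R u v u∈Y v∈Z q
      to x | inj₂ (i , j , q , inj₂ (eu , ev)) with β-one u u∈ eu | β-zero v ev
      ...   | u∈Z , refl | v∈Y , refl = trans (R-sym u v) (p⇒R v u v∈Y u∈Z q)
      across : ∀ a b → a ∈ Y → b ∈ Z → R a b ≡ true → R₁ a b ≡ true × R₁ b a ≡ true
      across a b a∈ b∈ r = proj₁ (proj₂ (proj₂ (proj₂ joined))) a b (ℓ₁ a) (ℓ₂ b)
        (∈-cartesianProduct⁺ (∈-allFin (ℓ₁ a)) (∈-allFin (ℓ₂ b)))
        (does-intro (cross? (ℓ₁ a) (ℓ₂ b)) (a , b , a∈ , b∈ , refl , refl , r))
        (sym (inY a a∈)) (sym (inZ b b∈))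
      from : R u v ≡ true → R₁ u v ≡ true
      from r with X⇒ u u∈ | X⇒ v v∈
      ... | inj₁ a | inj₁ b = proj₁ (proj₂ (proj₂ joined)) u v (∧-intro r (∨-introˡ (∧-intro a b)))
      ... | inj₂ a | inj₂ b = proj₁ (proj₂ (proj₂ joined)) u v (∧-intro r (∨-introʳ {Y u ∧ Y v} (∧-intro a b)))
      ... | inj₁ a | inj₂ b = proj₁ (across u v a b r)
      ... | inj₂ a | inj₁ b = proj₂ (across v u b a (trans (R-sym v u) r))

    β₁ β₂ : Fin m → Fin 3
    β₁ v = if ⌊ β₀ v ≟ zero ⌋ then suc (suc zero) else β₀ v
    β₂ v = if ⌊ β₁ v ≟ suc zero ⌋ then suc (suc zero) else β₁ v
    t₁ t₂ : Fin m → Fin M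
    t₁ v = if ⌊ β₀ v ≟ zero ⌋ then h₁ (ℓ₀ v) else ℓ₀ v
    t₂ v = if ⌊ β₁ v ≟ suc zero ⌋ then h₂ (t₁ v) else t₁ v

    -- Renaming types inside one bank could merge an old type with a new one. Both children are
    -- therefore emptied into the third bank before everything returns to bank zero.
    r-moved : Rep₃ R₁ X β₂ t₂
    r-moved = Rep-move {β = β₁} {t₁} (suc zero) (suc (suc zero)) (λ ()) h₂
      (Rep-move {β = β₀} {ℓ₀} zero (suc (suc zero)) (λ ()) h₁ (proj₁ (proj₂ joined)))

    r-final : Rep₃ R X (λ _ → zero) ℓ'
    r-final = Rep-cong (λ _ → refl) R₁≡R labels
      (Rep-move {β = β₂} {t₂} (suc (suc zero)) zero (λ ()) id r-moved)
      where
      labels : ∀ v → v ∈ X → combine {3} (if ⌊ β₂ v ≟ suc (suc zero) ⌋ then zero else β₂ v)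
        (if ⌊ β₂ v ≟ suc (suc zero) ⌋ then t₂ v else t₂ v) ≡ combine {3} zero (ℓ' v)
      labels v _ with Y v
      ... | true  = refl
      ... | false = refl

  realise : ∀ {X} → W (Lab k R U) X → X ⊆ U → (∀ v → v ∉ X) ⊎ Realised X
  realise (nil ∉X) _ = inj₁ ∉X
  realise (leaf lab v v∈ uniq) _ with Lab⇒Valid lab
  ... | ℓ , val = inj₂ (ℓ , val , Rep-vertex v _ v∈ uniq (R-irr v))
  realise (node {X} {Y} {Z} lab s t eq disj) X⊆U
    with realise s (λ v p → X⊆U v (trans (eq v) (∨-introˡ p))) | realise t (λ v p → X⊆U v (trans (eq v) (∨-introʳ p)))
  ... | inj₁ ∉Y | inj₁ ∉Z = inj₁ λ v → trans (eq v) (cong₂ _∨_ (∉Y v) (∉Z v))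
  ... | inj₁ ∉Y | inj₂ r = inj₂ (Realised-cong (λ v → sym (trans (eq v) (cong (_∨ Z v) (∉Y v)))) r)
  ... | inj₂ r | inj₁ ∉Z = inj₂ (Realised-cong (λ v → sym (trans (eq v)
          (trans (cong (Y v ∨_) (∉Z v)) (∨-identityʳ (Y v))))) r)
  ... | inj₂ r | inj₂ r' = inj₂ (realise-node X⊆U lab eq disj r r')

Width⇒CW : (G : Graph) {U : Sub (n G)} → (∀ v → v ∈ U) → 0 < n G → Width k (E G) U → CWAtMost (3 * 2 ^ k) G
Width⇒CW {k} G {U} all∈ 0<n t with Realise.realise k (E G) (E-sym G) (E-irr G) U t (λ _ → id)
... | inj₂ (_ , _ , r) = Rep-CW G all∈ r
... | inj₁ ∉U = ⊥-elim (empty G 0<n all∈ ∉U)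
  where
  empty : ∀ (G : Graph) {U : Sub (n G)} → 0 < n G → (∀ v → v ∈ U) → (∀ v → v ∉ U) → ⊥
  empty record { n = suc _ } _ all∈ ∉U = true≢false (all∈ zero) (∉U zero)

-- Walks and induced cycles in chordal graphs

module Adjacency (G : Graph) where

  V : Set
  V = Fin (n G)

  infix 4 _~_ _≁_
  _~_ _≁_ : V → V → Set
  u ~ v = E G u v ≡ true
  u ≁ v = E G u v ≡ false

  ~-sym : ∀ {u v} → u ~ v → v ~ u
  ~-sym {u} {v} p = trans (E-sym G v u) p

  ≁-sym : ∀ {u v} → u ≁ v → v ≁ u
  ≁-sym {u} {v} p = trans (E-sym G v u) p

  ~⇒≢ : ∀ {u v} → u ~ v → u ≢ v
  ~⇒≢ {u} p refl = true≢false p (E-irr G u)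

  -- Only the interior vertices of a Path are required to satisfy S.
  data Path (S : V → Set) : V → V → Set where
    edge : ∀ {a b} → a ~ b → Path S a b
    step : ∀ {a b c} → a ~ b → S b → Path S b c → Path S a c

  data Walk (S : V → Set) : V → V → Set where
    stop : ∀ {a} → S a → Walk S a a
    step : ∀ {a b c} → S a → a ~ b → Walk S b c → Walk S a c

  Path-map : ∀ {S T : V → Set} {a b} → (∀ {v} → S v → T v) → Path S a b → Path T a b
  Path-map f (edge p)     = edge p
  Path-map f (step p s r) = step p (f s) (Path-map f r)

  Path-snoc : ∀ {S a b c} → Path S a b → S b → b ~ c → Path S a c
  Path-snoc (edge p) s q     = step p s (edge q)
  Path-snoc (step p t r) s q = step p t (Path-snoc r s q)

  Walk-map : ∀ {S T : V → Set} {a b} → (∀ {v} → S v → T v) → Walk S a b → Walk T a b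
  Walk-map f (stop s)     = stop (f s)
  Walk-map f (step s p r) = step (f s) p (Walk-map f r)

  Walk-++ : ∀ {S a b c} → Walk S a b → Walk S b c → Walk S a c
  Walk-++ (stop _) w     = w
  Walk-++ (step s p r) w = step s p (Walk-++ r w)

  Walk-start : ∀ {S a b} → Walk S a b → S a
  Walk-start (stop s)     = s
  Walk-start (step s _ _) = s

  Walk-rev : ∀ {S a b} → Walk S a b → Walk S b a
  Walk-rev (stop s)     = stop s
  Walk-rev (step s p r) = Walk-++ (Walk-rev r) (step (Walk-start r) (~-sym p) (stop s))

  Walk⇒Path : ∀ {S y a b y'} → y ~ a → Walk S a b → b ~ y' → Path S y y'
  Walk⇒Path p (stop s) q     = step p s (edge q)
  Walk⇒Path p (step s r w) q = step p s (Walk⇒Path r w q)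

  Walk⇒Path-end : ∀ {S a b c} → Walk S a b → b ~ c → Path S a c
  Walk⇒Path-end (stop _) q     = edge q
  Walk⇒Path-end (step _ p w) q = step p (Walk-start w) (Walk⇒Path-end w q)

  Walk⇒≡⊎Path : ∀ {S a b} → Walk S a b → a ≡ b ⊎ Path S a b
  Walk⇒≡⊎Path (stop _) = inj₁ refl
  Walk⇒≡⊎Path (step _ p w) with Walk⇒≡⊎Path w
  ... | inj₁ refl = inj₂ (edge p)
  ... | inj₂ r    = inj₂ (step p (Walk-start w) r)

  mutual
    data Induced (S : V → Set) : V → V → Set where
      end  : ∀ {a b} → a ~ b → Induced S a b
      cons : ∀ {a p b} → a ~ p → S p → (q : Induced S p b) → Far a q → Induced S a b

    -- Far a q: a differs from, and is not adjacent to, every vertex of q except possibly the first.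
    Far : ∀ {S p b} → V → Induced S p b → Set
    Far {b = b} a (end _)          = b ≢ a × a ≁ b
    Far a (cons {p = p} _ _ q _) = p ≢ a × a ≁ p × Far a q

  -- The search starts at the far end: the last vertex of `q` after its first that equals `a` or is
  -- adjacent to it gives a chordless shortcut. If there is none, `a` can be put in front of `q`
  -- without creating a chord.
  scan : ∀ {S p b} a → a ≢ b → (q : Induced S p b) → Far a q ⊎ Induced S a b
  scan {b = b} a a≢b (end _) with dichotomy (E G a b)
  ... | inj₁ a~b = inj₂ (end a~b)
  ... | inj₂ a≁b = inj₁ ((λ e → a≢b (sym e)) , a≁b)
  scan a a≢b (cons {p = p} _ s q _) with scan a a≢b q
  ... | inj₂ r = inj₂ r
  ... | inj₁ far with p ≟ a | dichotomy (E G a p)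
  ...   | yes refl | _        = inj₂ q
  ...   | no _     | inj₁ a~p = inj₂ (cons a~p s q far)
  ...   | no p≢a   | inj₂ a≁p = inj₁ (p≢a , a≁p , far)

  shorten : ∀ {S a b} → a ≢ b → Path S a b → Induced S a b
  shorten a≢b (edge p) = end p
  shorten {a = a} {b} a≢b (step {b = p} a~p s r) with p ≟ b
  ... | yes refl = end a~p
  ... | no p≢b with shorten p≢b r
  ...   | q with scan a a≢b q
  ...     | inj₂ r' = r'
  ...     | inj₁ far = cons a~p s q far

  edges : ∀ {S a b} → Induced S a b → ℕ
  edges (end _)        = 1
  edges (cons _ _ q _) = suc (edges q)

  len : ∀ {S a b} → Induced S a b → ℕ
  len q = suc (edges q)

  vert : ∀ {S a b} (q : Induced S a b) → Fin (len q) → V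
  vert {a = a} (end _) zero              = a
  vert {b = b} (end _) (suc zero)        = b
  vert {a = a} (cons _ _ q _) zero       = a
  vert (cons _ _ q _) (suc i)            = vert q i

  pathAdj : ℕ → ℕ → Bool
  pathAdj i j = (suc i ≡ᵇ j) ∨ (suc j ≡ᵇ i)

  far-vert : ∀ {S p b a} (q : Induced S p b) → Far a q → ∀ i → 0 < toℕ i → vert q i ≢ a × a ≁ vert q i
  far-vert (end _) far (suc zero) _ = far
  far-vert (cons _ _ (end _) _) (p , q , _) (suc zero) _ = p , q
  far-vert (cons _ _ (cons _ _ _ _) _) (p , q , _) (suc zero) _ = p , q
  far-vert (cons _ _ q _) (_ , _ , far) (suc (suc i)) _ = far-vert q far (suc i) (s≤s z≤n)

  vert-adj : ∀ {S a b} (q : Induced S a b) i j → E G (vert q i) (vert q j) ≡ pathAdj (toℕ i) (toℕ j)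
  vert-adj (end {a} a~b) zero zero            = E-irr G a
  vert-adj (end a~b) zero (suc zero)          = a~b
  vert-adj (end a~b) (suc zero) zero          = ~-sym a~b
  vert-adj (end {b = b} a~b) (suc zero) (suc zero) = E-irr G b
  vert-adj (cons {a} _ _ _ _) zero zero       = E-irr G a
  vert-adj (cons a~p _ (end _) _) zero (suc zero) = a~p
  vert-adj (cons a~p _ (cons _ _ _ _) _) zero (suc zero) = a~p
  vert-adj (cons a~p _ (end _) _) (suc zero) zero = ~-sym a~p
  vert-adj (cons a~p _ (cons _ _ _ _) _) (suc zero) zero = ~-sym a~p
  vert-adj (cons _ _ q far) zero (suc (suc j)) = proj₂ (far-vert q far (suc j) (s≤s z≤n))
  vert-adj (cons _ _ q far) (suc (suc i)) zero = ≁-sym (proj₂ (far-vert q far (suc i) (s≤s z≤n)))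
  vert-adj (cons _ _ q _) (suc i) (suc j)     = vert-adj q i j

  vert-inj : ∀ {S a b} (q : Induced S a b) i j → vert q i ≡ vert q j → i ≡ j
  vert-inj (end _) zero zero _ = refl
  vert-inj (end p) zero (suc zero) e = ⊥-elim (~⇒≢ p e)
  vert-inj (end p) (suc zero) zero e = ⊥-elim (~⇒≢ p (sym e))
  vert-inj (end _) (suc zero) (suc zero) _ = refl
  vert-inj (cons _ _ _ _) zero zero _ = refl
  vert-inj (cons p _ (end _) _) zero (suc zero) e = ⊥-elim (~⇒≢ p e)
  vert-inj (cons p _ (cons _ _ _ _) _) zero (suc zero) e = ⊥-elim (~⇒≢ p e)
  vert-inj (cons p _ (end _) _) (suc zero) zero e = ⊥-elim (~⇒≢ p (sym e))
  vert-inj (cons p _ (cons _ _ _ _) _) (suc zero) zero e = ⊥-elim (~⇒≢ p (sym e))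
  vert-inj (cons _ _ q far) zero (suc (suc j)) e = ⊥-elim (proj₁ (far-vert q far (suc j) (s≤s z≤n)) (sym e))
  vert-inj (cons _ _ q far) (suc (suc i)) zero e = ⊥-elim (proj₁ (far-vert q far (suc i) (s≤s z≤n)) e)
  vert-inj (cons _ _ q _) (suc i) (suc j) e = cong suc (vert-inj q i j e)

  module Cone (c : V) where

    Off : V → Set
    Off v = v ≢ c × c ≁ v

    tail-adj : ∀ {a b} (q : Induced Off a b) → c ~ b → ∀ i → 0 < toℕ i →
      E G c (vert q i) ≡ (suc (toℕ i) ≡ᵇ len q) × vert q i ≢ c
    tail-adj (end _) c~b (suc zero) _ = c~b , λ e → ~⇒≢ c~b (sym e)
    tail-adj (cons _ (p≢c , c≁p) (end _) _) c~b (suc zero) _ = c≁p , p≢c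
    tail-adj (cons _ (p≢c , c≁p) (cons _ _ (end _) _) _) c~b (suc zero) _ = c≁p , p≢c
    tail-adj (cons _ (p≢c , c≁p) (cons _ _ (cons _ _ _ _) _) _) c~b (suc zero) _ = c≁p , p≢c
    tail-adj (cons _ _ q _) c~b (suc (suc i)) _ = tail-adj q c~b (suc i) (s≤s z≤n)

    cone-adj : ∀ {a b} (q : Induced Off a b) → c ~ a → c ~ b → ∀ i →
      E G c (vert q i) ≡ (0 ≡ᵇ toℕ i) ∨ (suc (toℕ i) ≡ᵇ len q)
    cone-adj (end _) c~a _ zero        = c~a
    cone-adj (cons _ _ _ _) c~a _ zero = c~a
    cone-adj q _ c~b (suc i)           = proj₁ (tail-adj q c~b (suc i) (s≤s z≤n))

    vert≢ : ∀ {a b} (q : Induced Off a b) → c ~ a → c ~ b → ∀ i → vert q i ≢ c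
    vert≢ (end _) c~a _ zero        = λ e → ~⇒≢ c~a (sym e)
    vert≢ (cons _ _ _ _) c~a _ zero = λ e → ~⇒≢ c~a (sym e)
    vert≢ q _ c~b (suc i)           = proj₂ (tail-adj q c~b (suc i) (s≤s z≤n))

    -- With `c` at position 0, its neighbours on the path are position 1 and the last position, the
    -- latter matching the wrap-around edge in the definition of `C`.
    cycle : ∀ {a b} (q : Induced Off a b) → c ~ a → c ~ b → IsInducedSubgraph (C (suc (len q))) G
    cycle q c~a c~b = f , inj , adjEq
      where
      f : Fin (suc (len q)) → V
      f zero    = c
      f (suc i) = vert q i
      inj : ∀ {x y} → f x ≡ f y → x ≡ y
      inj {zero}  {zero}  e = refl
      inj {zero}  {suc j} e = ⊥-elim (vert≢ q c~a c~b j (sym e))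
      inj {suc i} {zero}  e = ⊥-elim (vert≢ q c~a c~b i e)
      inj {suc i} {suc j} e = cong suc (vert-inj q i j e)
      adjEq : ∀ x y → E G (f x) (f y) ≡ E (C (suc (len q))) x y
      adjEq zero zero    = E-irr G c
      adjEq zero (suc j) = trans (cone-adj q c~a c~b j) (cong (_∨ (suc (toℕ j) ≡ᵇ len q)) (sym (∨-identityʳ (0 ≡ᵇ toℕ j))))
      adjEq (suc i) zero = trans (E-sym G (vert q i) c) (trans (cone-adj q c~a c~b i)
        (trans (∨-comm (0 ≡ᵇ toℕ i) (suc (toℕ i) ≡ᵇ len q))
          (cong ((suc (toℕ i) ≡ᵇ len q) ∨_) (sym (∨-identityʳ (0 ≡ᵇ toℕ i))))))
      adjEq (suc i) (suc j) with suc i ≟ suc j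
      ... | yes refl = E-irr G (vert q i)
      ... | no _ = trans (vert-adj q i j) (cong₂ _∨_ (sym (∨-identityʳ (suc (toℕ i) ≡ᵇ toℕ j)))
          (sym (∨-identityʳ (suc (toℕ j) ≡ᵇ toℕ i))))

  DiamondFree : Sub (n G) → Set
  DiamondFree D = ∀ a b c d → a ∈ D → b ∈ D → c ∈ D → d ∈ D → a ≢ b → a ≁ b → c ~ d →
    a ~ c → a ~ d → b ~ c → b ~ d → ⊥

  DiamondFree-⊆ : ∀ {D D'} → D' ⊆ D → DiamondFree D → DiamondFree D'
  DiamondFree-⊆ D'⊆D df a b c d a∈ b∈ c∈ d∈ =
    df a b c d (D'⊆D a a∈) (D'⊆D b b∈) (D'⊆D c c∈) (D'⊆D d d∈)

module ChordalGraph (G : Graph) (chordal : Chordal G) where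
  open Adjacency G

  -- The path is shortened to a chordless one. As its ends are non-adjacent it keeps an inner
  -- vertex, so together with `c` it forms an induced cycle of length at least four.
  no-cone : ∀ {c y y'} → c ~ y → c ~ y' → y ≢ y' → y ≁ y' → Path (λ v → v ≢ c × c ≁ v) y y' → ⊥
  no-cone {c} c~y c~y' y≢y' y≁y' path with shorten y≢y' path
  ... | end y~y' = true≢false y~y' y≁y'
  ... | q@(cons _ _ q' _) = chordal (suc (len q)) (s≤s (s≤s (2≤ q'))) (Cone.cycle c q c~y c~y')
    where
    2≤ : ∀ {S a b} (q : Induced S a b) → 2 ≤ len q
    2≤ (end _)        = s≤s (s≤s z≤n)
    2≤ (cons _ _ q _) = s≤s (s≤s z≤n)

  no-C₄ : ∀ {a b c d} → a ~ b → b ~ c → c ~ d → d ~ a → a ≢ c → b ≢ d → a ≁ c → b ≁ d → ⊥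
  no-C₄ ab bc cd da a≢c b≢d a≁c b≁d =
    no-cone ab (~-sym da) b≢d b≁d (step bc ((λ e → a≢c (sym e)) , a≁c) (edge cd))

  -- In a diamond-free chordal graph the neighbours of x in one component of D ∖ x are pairwise adjacent:
  -- consecutive visits of a path to N(x) are adjacent by chordality, and adjacency is
  -- transitive inside N(x) by diamond-freeness.
  neighbours-linked : ∀ {D x y y'} → DiamondFree D → x ∈ D → y ∈ D → y' ∈ D → x ~ y → x ~ y' →
    Path (λ v → v ∈ D × v ≢ x) y y' → y ≡ y' ⊎ y ~ y'
  neighbours-linked {D} {x} df x∈ = λ y∈ y'∈ x~y x~y' → go y∈ y'∈ x~y x~y' (inj₁ refl)
    where
    Off : V → Set
    Off v = v ≢ x × x ≁ v
    snoc : ∀ {y z w} → y ≡ z ⊎ (Path Off y z × Off z) → z ~ w → Path Off y w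
    snoc (inj₁ refl) p     = edge p
    snoc (inj₂ (r , s)) p = Path-snoc r s p
    close : ∀ {y w} → x ~ y → x ~ w → Path Off y w → y ≡ w ⊎ y ~ w
    close {y} {w} x~y x~w r with y ≟ w | dichotomy (E G y w)
    ... | yes e   | _      = inj₁ e
    ... | no _    | inj₁ p = inj₂ p
    ... | no y≢w | inj₂ p = ⊥-elim (no-cone x~y x~w y≢w p r)
    compose : ∀ {y w z} → y ∈ D → w ∈ D → z ∈ D → x ~ y → x ~ w → x ~ z →
      y ≡ w ⊎ y ~ w → w ≡ z ⊎ w ~ z → y ≡ z ⊎ y ~ z
    compose y∈ w∈ z∈ xy xw xz (inj₁ refl) q = q
    compose y∈ w∈ z∈ xy xw xz (inj₂ p) (inj₁ refl) = inj₂ p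
    compose {y} {w} {z} y∈ w∈ z∈ xy xw xz (inj₂ p) (inj₂ q) with y ≟ z | dichotomy (E G y z)
    ... | yes e  | _      = inj₁ e
    ... | no _   | inj₁ r = inj₂ r
    ... | no y≢z | inj₂ r = ⊥-elim (df y z x w y∈ z∈ x∈ w∈ y≢z r xw (~-sym xy) p (~-sym xz) (~-sym q))
    -- Here `y` is the last neighbour of `x` that was visited and `z` the current vertex; `past` is
    -- the stretch between them, which meets no further neighbour of `x`.
    go : ∀ {y z y'} → y ∈ D → y' ∈ D → x ~ y → x ~ y' → y ≡ z ⊎ (Path Off y z × Off z) →
      Path (λ v → v ∈ D × v ≢ x) z y' → y ≡ y' ⊎ y ~ y'
    go y∈ y'∈ x~y x~y' past (edge p) = close x~y x~y' (snoc past p)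
    go y∈ y'∈ x~y x~y' past (step {b = w} p (w∈ , w≢x) r) with dichotomy (E G x w)
    ... | inj₂ x≁w = go y∈ y'∈ x~y x~y' (inj₂ (snoc past p , w≢x , x≁w)) r
    ... | inj₁ x~w = compose y∈ w∈ y'∈ x~y x~w x~y' (close x~y x~w (snoc past p))
                       (go w∈ y'∈ x~w x~y' (inj₁ refl) r)

-- Separations and simplicial vertices

-- The recursion is on the size of the complement. It serves both for maximal connected sets and for
-- closing a set under components.
grow : {Q Stop : Sub m → Set} →
  (∀ X → Q X → Stop X ⊎ ∃[ Y ] Q Y × X ⊆ Y × ∃[ v ] v ∈ Y × v ∉ X) →
  ∀ X → Q X → ∃[ Y ] Q Y × Stop Y
grow {Q = Q} {Stop} next X q = go X q (<-wellFounded _)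
  where
  go : ∀ X → Q X → Acc _<_ (count (not ∘ X)) → ∃[ Y ] Q Y × Stop Y
  go X q (acc rs) with next X q
  ... | inj₁ s = X , q , s
  ... | inj₂ (Y , q' , X⊆Y , v , v∈Y , v∉X) = go Y q' (rs (count-⊂ (not ∘ Y) (not ∘ X)
          (λ u u∈ → cong not (¬-not λ u∈X → true≢false (X⊆Y u u∈X) (not-true⇒ u∈)))
          v (cong not v∉X) (cong not v∈Y)))

module Separations (G : Graph) (chordal : Chordal G) where
  open Adjacency G
  open ChordalGraph G chordal

  -- `U` falls into `X`, `F` and a remainder that has no name of its own; call it N. It is the
  -- neighbourhood of `X`, separates `X` from the nonempty `F` and is complete to `F`. This one
  -- structure yields both simplicial vertices and the elimination steps for block graphs.
  record Separation (U : Sub (n G)) (a : V) : Set where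
    field
      X        : Sub (n G)
      X⊆U      : X ⊆ U
      a∈X      : a ∈ X
      X-conn   : ∀ v → v ∈ X → Walk (_∈ X) a v
      F        : Sub (n G)
      F⊆U      : F ⊆ U
      c₀       : V
      c₀∈F     : c₀ ∈ F
      F∩X      : ∀ {c} → c ∈ F → c ∉ X
      F≁X      : ∀ {c x} → c ∈ F → x ∈ X → c ≁ x
      N~X      : ∀ {v} → v ∈ U → v ∉ X → v ∉ F → ∃[ x ] x ∈ X × x ~ v
      N~F      : ∀ {v c} → v ∈ U → v ∉ X → v ∉ F → c ∈ F → v ~ c

    X-path : ∀ {x x' y y'} → x ∈ X → x' ∈ X → y ~ x → x' ~ y' → Path (_∈ X) y y'
    X-path x∈ x'∈ p q = Walk⇒Path p (Walk-++ (Walk-rev (X-conn _ x∈)) (X-conn _ x'∈)) q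

    -- Two non-adjacent vertices of N would be joined by a path through the connected set `X`, and
    -- `c₀` is adjacent to its two ends but to nothing inside it.
    N-clique : ∀ {u v} → u ∈ U → u ∉ X → u ∉ F → v ∈ U → v ∉ X → v ∉ F → u ≢ v → u ~ v
    N-clique {u} {v} u∈ u∉X u∉F v∈ v∉X v∉F u≢v with dichotomy (E G u v) | N~X u∈ u∉X u∉F | N~X v∈ v∉X v∉F
    ... | inj₁ p | _ | _ = p
    ... | inj₂ u≁v | x , x∈ , x~u | x' , x'∈ , x'~v = ⊥-elim
      (no-cone (~-sym (N~F u∈ u∉X u∉F c₀∈F)) (~-sym (N~F v∈ v∉X v∉F c₀∈F)) u≢v u≁v
        (Path-map (λ w∈ → (λ { refl → true≢false w∈ (F∩X c₀∈F) }) , F≁X c₀∈F w∈) (X-path x∈ x'∈ (~-sym x~u) x'~v)))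

    F-neighbour : ∀ {c u} → c ∈ F → u ∈ U → c ~ u → u ∈ F ⊎ (u ∉ X × u ∉ F)
    F-neighbour {c} {u} c∈ u∈ p with dichotomy (F u)
    ... | inj₁ u∈F = inj₁ u∈F
    ... | inj₂ u∉F = inj₂ (¬-not (λ u∈X → true≢false p (F≁X c∈ u∈X)) , u∉F)

  module Maximal (U : Sub (n G)) (a : V) where

    Out : Sub (n G) → V → Set
    Out X c = c ∈ U × c ∉ X × (∀ x → x ∈ X → x ≁ c)

    out? : ∀ X c → Dec (Out X c)
    out? X c = ≡true? (U c) ×-dec ≡false? (X c) ×-dec all? λ x → ≡true? (X x) →-dec ≡false? (E G x c)

    Connected Full : Sub (n G) → Set
    Connected X = X ⊆ U × a ∈ X × (∀ v → v ∈ X → Walk (_∈ X) a v) × ∃ (Out X)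
    Full X = ∀ v c → v ∈ U → v ∉ X → (∃[ x ] x ∈ X × x ~ v) → Out X c → v ~ c

    module Extend {X : Sub (n G)} {v x : V} (x∈ : x ∈ X) (x~v : x ~ v) where
      Y : Sub (n G)
      Y = X ∪ ⟨ v ⟩

      X⊆Y : X ⊆ Y
      X⊆Y _ = ∨-introˡ

      v∈Y : v ∈ Y
      v∈Y = ∨-introʳ {X v} (⟨⟩-self v)

      split : ∀ {u} → u ∈ Y → u ∈ X ⊎ u ≡ v
      split {u} p with ∨-elim {X u} p
      ... | inj₁ q = inj₁ q
      ... | inj₂ q = inj₂ (⟨⟩-elim q)

      connected : v ∈ U → ∀ {c} → Out X c → v ≁ c → Connected X → Connected Y
      connected v∈U {c} (c∈ , c∉ , c≁) v≁c (X⊆U , a∈X , conn , _) =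
        Y⊆U , ∨-introˡ a∈X , conn' , c , c∈ , c∉Y , c≁Y
        where
        Y⊆U : Y ⊆ U
        Y⊆U u p with split p
        ... | inj₁ q    = X⊆U u q
        ... | inj₂ refl = v∈U
        conn' : ∀ u → u ∈ Y → Walk (_∈ Y) a u
        conn' u p with split p
        ... | inj₁ q    = Walk-map (X⊆Y _) (conn u q)
        ... | inj₂ refl = Walk-++ (Walk-map (X⊆Y _) (conn x x∈)) (step (X⊆Y x x∈) x~v (stop v∈Y))
        c∉Y : c ∉ Y
        c∉Y = ¬-not λ p → [ (λ q → true≢false q c∉) , (λ { refl → true≢false x~v (c≁ x x∈) }) ]′ (split p)
        c≁Y : ∀ u → u ∈ Y → u ≁ c
        c≁Y u p with split p
        ... | inj₁ q    = c≁ u q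
        ... | inj₂ refl = v≁c

    next : ∀ X → Connected X → Full X ⊎ ∃[ Y ] Connected Y × X ⊆ Y × ∃[ v ] v ∈ Y × v ∉ X
    next X conn with any? (λ v → any? λ c → any? λ x →
        ≡true? (U v) ×-dec ≡false? (X v) ×-dec ≡true? (X x) ×-dec ≡true? (E G x v) ×-dec
        out? X c ×-dec ≡false? (E G v c))
    ... | no none = inj₁ λ { v c v∈ v∉ (x , x∈ , x~v) oc → [ id ,
            (λ v≁c → ⊥-elim (none (v , c , x , v∈ , v∉ , x∈ , x~v , oc , v≁c))) ]′ (dichotomy (E G v c)) }
    ... | yes (v , c , x , v∈ , v∉ , x∈ , x~v , oc , v≁c) =
      inj₂ (Extend.Y x∈ x~v , Extend.connected x∈ x~v v∈ oc v≁c conn , Extend.X⊆Y x∈ x~v , v , Extend.v∈Y x∈ x~v , v∉)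

    start : ∀ {b} → a ∈ U → b ∈ U → a ≢ b → a ≁ b → Connected ⟨ a ⟩
    start {b} a∈U b∈U a≢b a≁b = (λ v p → subst (_∈ U) (sym (⟨⟩-elim p)) a∈U) , ⟨⟩-self a ,
      (λ v p → subst (Walk _ a) (sym (⟨⟩-elim p)) (stop (⟨⟩-self a))) ,
      b , b∈U , does-false-intro (b ≟ a) (λ e → a≢b (sym e)) , λ x p → subst (_≁ b) (sym (⟨⟩-elim p)) a≁b

    separation : (∃[ X ] Connected X × Full X) → Separation U a
    separation (X , (X⊆U , a∈X , conn , c , oc) , full) = record
      { X = X ; X⊆U = X⊆U ; a∈X = a∈X ; X-conn = conn ; F = ⟪ out? X ⟫
      ; F⊆U = λ v p → proj₁ (out v p) ; c₀ = c ; c₀∈F = does-intro (out? X c) oc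
      ; F∩X = λ {c} p → proj₁ (proj₂ (out c p)) ; F≁X = λ {c} {x} p x∈ → ≁-sym (proj₂ (proj₂ (out c p)) x x∈)
      ; N~X = N~X
      ; N~F = λ v∈ v∉X v∉F c∈ → full _ _ v∈ v∉X (N~X v∈ v∉X v∉F) (out _ c∈) }
      where
      out : ∀ v → v ∈ ⟪ out? X ⟫ → Out X v
      out v = does-elim (out? X v)
      N~X : ∀ {v} → v ∈ U → v ∉ X → v ∉ ⟪ out? X ⟫ → ∃[ x ] x ∈ X × x ~ v
      N~X {v} v∈ v∉ v∉F with any? (λ x → ≡true? (X x) ×-dec ≡true? (E G x v))
      ... | yes r = r
      ... | no ¬r = ⊥-elim (does-false-elim (out? X v) v∉F (v∈ , v∉ , λ x x∈ → ¬-not λ p → ¬r (x , x∈ , p)))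

  -- Take X maximal among the connected sets containing a for which some vertex lies outside
  -- X and its neighbourhood; by maximality the neighbourhood is complete to those vertices.
  separate : ∀ U {a b} → a ∈ U → b ∈ U → a ≢ b → a ≁ b → Separation U a
  separate U {a} a∈ b∈ a≢b a≁b = separation (grow next ⟨ a ⟩ (start a∈ b∈ a≢b a≁b))
    where open Maximal U a

  Clique : Sub (n G) → Set
  Clique U = ∀ u v → u ∈ U → v ∈ U → u ≢ v → u ~ v

  clique? : ∀ U → Clique U ⊎ ∃[ u ] ∃[ v ] u ∈ U × v ∈ U × u ≢ v × u ≁ v
  clique? U with any? (λ u → any? λ v → ≡true? (U u) ×-dec ≡true? (U v) ×-dec ¬? (u ≟ v) ×-dec ≡false? (E G u v))
  ... | yes p = inj₂ p
  ... | no ¬p = inj₁ λ u v u∈ v∈ u≢v → [ id , (λ q → ⊥-elim (¬p (u , v , u∈ , v∈ , u≢v , q))) ]′ (dichotomy (E G u v))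

  Simplicial : Sub (n G) → V → Set
  Simplicial U q = q ∈ U × (∀ u v → u ∈ U → v ∈ U → q ~ u → q ~ v → u ≢ v → u ~ v)

  -- A form of Dirac's theorem suited to induction. A simplicial vertex of `F` remains simplicial in
  -- `U`, because its further neighbours lie in N, a clique that is complete to `F`. Being in `F`,
  -- it is also far from `a`.
  simplicial-away : ∀ U {a b} → a ∈ U → b ∈ U → a ≢ b → a ≁ b → ∃[ q ] Simplicial U q × q ≢ a × a ≁ q
  simplicial-away U = go U (<-wellFounded _)
    where
    go : ∀ U → Acc _<_ (count U) → ∀ {a b} → a ∈ U → b ∈ U → a ≢ b → a ≁ b →
         ∃[ q ] Simplicial U q × q ≢ a × a ≁ q
    go U (acc rs) {a} a∈ b∈ a≢b a≁b = inside (clique? F)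
      where
      open Separation (separate U a∈ b∈ a≢b a≁b)
      lift : ∀ q → Simplicial F q → ∃[ q ] Simplicial U q × q ≢ a × a ≁ q
      lift q (q∈ , simp) = q , (F⊆U q q∈ , simp') , (λ { refl → true≢false a∈X (F∩X q∈) }) , ≁-sym (F≁X q∈ a∈X)
        where
        simp' : ∀ u v → u ∈ U → v ∈ U → q ~ u → q ~ v → u ≢ v → u ~ v
        simp' u v u∈ v∈ qu qv u≢v with F-neighbour q∈ u∈ qu | F-neighbour q∈ v∈ qv
        ... | inj₁ u∈F | inj₁ v∈F = simp u v u∈F v∈F qu qv u≢v
        ... | inj₁ u∈F | inj₂ (v∉X , v∉F) = ~-sym (N~F v∈ v∉X v∉F u∈F)
        ... | inj₂ (u∉X , u∉F) | inj₁ v∈F = N~F u∈ u∉X u∉F v∈F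
        ... | inj₂ (u∉X , u∉F) | inj₂ (v∉X , v∉F) = N-clique u∈ u∉X u∉F v∈ v∉X v∉F u≢v
      inside : (Clique F ⊎ ∃[ u ] ∃[ v ] u ∈ F × v ∈ F × u ≢ v × u ≁ v) → ∃[ q ] Simplicial U q × q ≢ a × a ≁ q
      inside (inj₁ cl) = lift c₀ (c₀∈F , λ u v u∈ v∈ _ _ → cl u v u∈ v∈)
      inside (inj₂ (u , v , u∈ , v∈ , u≢v , u≁v)) with
        go F (rs (count-⊂ F U F⊆U a a∈ (¬-not λ a∈F → true≢false a∈X (F∩X a∈F)))) u∈ v∈ u≢v u≁v
      ... | q , s , _ = lift q s

  simplicial-exists : ∀ U {a} → a ∈ U → ∃[ q ] Simplicial U q
  simplicial-exists U {a} a∈ with clique? U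
  ... | inj₁ cl = a , a∈ , λ u v u∈ v∈ _ _ → cl u v u∈ v∈
  ... | inj₂ (u , v , u∈ , v∈ , u≢v , u≁v) with simplicial-away U u∈ v∈ u≢v u≁v
  ...   | q , s , _ = q , s

-- Block graphs and co-bipartite chain graphs

-- The leaf of `v` is replaced by a node with the leaves `v` and `w`. So `w` enters exactly the
-- larger sets that contain `v`, certified by `ext`; the sets without `v` are kept by `lift`, and
-- `one` certifies the two leaves.
W-insert : ∀ {L L' : Sub m → Set} {v w} → (∀ u Y → (∀ z → z ∈ Y → z ≡ u) → L' Y) →
  ∀ {X} → w ∉ X → (∀ Y → Y ⊆ X → v ∉ Y → L Y → L' Y) → (∀ Y → Y ⊆ X → v ∈ Y → L Y → L' (Y ∪ ⟨ w ⟩)) →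
  v ∈ X → W L X → W L' (X ∪ ⟨ w ⟩)
W-insert one w∉ lift ext v∈ (nil ∉X) = ⊥-elim (true≢false v∈ (∉X _))
W-insert {w = w} one {X} w∉ lift ext v∈ (leaf l u u∈ uniq) =
  node (ext X (λ _ → id) v∈ l) (leaf (one u X uniq) u u∈ uniq)
       (leaf (one w ⟨ w ⟩ (λ _ → ⟨⟩-elim)) w (⟨⟩-self w) (λ _ → ⟨⟩-elim)) (λ _ → refl)
       (λ z p q → true≢false p (subst (_∉ X) (sym (⟨⟩-elim q)) w∉))
W-insert {v = v} {w} one {X} w∉ lift ext v∈ (node {Y = Y} {Z} l s t eq disj) with dichotomy (Y v)
... | inj₁ v∈Y = node (ext X (λ _ → id) v∈ l)
      (W-insert one (¬-not λ w∈Y → true≢false (Y⊆X w w∈Y) w∉)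
        (λ A A⊆ → lift A (λ z → Y⊆X z ∘ A⊆ z)) (λ A A⊆ → ext A (λ z → Y⊆X z ∘ A⊆ z)) v∈Y s)
      (W-map (λ A A⊆ → lift A (λ z → Z⊆X z ∘ A⊆ z) (¬-not λ v∈A → disj v v∈Y (A⊆ v v∈A))) t) eq'
      (λ z p q → [ (λ r → disj z r q)
                 , (λ r → true≢false (Z⊆X z q) (subst (_∉ X) (sym (⟨⟩-elim r)) w∉)) ]′ (∨-elim {Y z} p))
  where
  Y⊆X : Y ⊆ X
  Y⊆X z p = trans (eq z) (∨-introˡ p)
  Z⊆X : Z ⊆ X
  Z⊆X z p = trans (eq z) (∨-introʳ p)
  eq' : ∀ z → X z ∨ ⟨ w ⟩ z ≡ (Y z ∨ ⟨ w ⟩ z) ∨ Z z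
  eq' z rewrite eq z with Y z | Z z
  ... | true  | _     = refl
  ... | false | true  = sym (∨-zeroʳ _)
  ... | false | false = sym (∨-identityʳ _)
... | inj₂ v∉Y = node (ext X (λ _ → id) v∈ l)
      (W-map (λ A A⊆ → lift A (λ z → Y⊆X z ∘ A⊆ z) (¬-not λ v∈A → true≢false (A⊆ v v∈A) v∉Y)) s)
      (W-insert one (¬-not λ w∈Z → true≢false (Z⊆X w w∈Z) w∉)
        (λ A A⊆ → lift A (λ z → Z⊆X z ∘ A⊆ z)) (λ A A⊆ → ext A (λ z → Z⊆X z ∘ A⊆ z)) v∈Z t) eq'
      (λ z p q → [ disj z p
                 , (λ r → true≢false (Y⊆X z p) (subst (_∉ X) (sym (⟨⟩-elim r)) w∉)) ]′ (∨-elim {Z z} q))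
  where
  Y⊆X : Y ⊆ X
  Y⊆X z p = trans (eq z) (∨-introˡ p)
  Z⊆X : Z ⊆ X
  Z⊆X z p = trans (eq z) (∨-introʳ p)
  v∈Z : v ∈ Z
  v∈Z = [ (λ r → ⊥-elim (true≢false r v∉Y)) , id ]′ (∨-elim (trans (sym (eq v)) v∈))
  eq' : ∀ z → X z ∨ ⟨ w ⟩ z ≡ Y z ∨ (Z z ∨ ⟨ w ⟩ z)
  eq' z rewrite eq z with Y z
  ... | true  = refl
  ... | false = refl

─-restore : ∀ {U : Sub m} {w} → w ∈ U → ∀ v → ((U ─ w) ∪ ⟨ w ⟩) v ≡ U v
─-restore {U = U} {w} w∈ v with v ≟ w
... | yes refl = trans (∨-zeroʳ _) (sym w∈)
... | no _ with U v
...   | true  = refl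
...   | false = refl

∉─ : ∀ {U : Sub m} {w} → w ∉ U ─ w
∉─ {U = U} = ¬-not λ p → proj₂ (∈─-elim {X = U} p) refl

-- The cut between X and U ∖ X has rank at most one; false marks the zero rows.
Lab₁ : (R : Adj m) (U X : Sub m) → Set
Lab₁ {m} R U X = Σ (Fin m → Bool) λ ℓ →
  (∀ u → u ∈ X → ℓ u ≡ false → ∀ w → w ∈ U → w ∉ X → R u w ≡ false) ×
  (∀ u v → u ∈ X → v ∈ X → ℓ u ≡ true → ℓ v ≡ true → ∀ w → w ∈ U → w ∉ X → R u w ≡ R v w)

Lab₁⇒Lab : ∀ {R : Adj m} {U X} → Lab₁ R U X → Lab 1 R U X
Lab₁⇒Lab {R = R} (ℓ , zero-row , same) = (λ v → ℓ v ∷ []) , go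
  where
  go : ∀ u v → _ → _ → ℓ u ∷ [] ≡ ℓ v ∷ [] → ∀ w → _ → _ → R u w ≡ R v w
  go u v u∈ v∈ e w w∈ w∉ with dichotomy (ℓ u)
  ... | inj₁ t = same u v u∈ v∈ t (trans (sym (proj₁ (∷-inj e))) t) w w∈ w∉
  ... | inj₂ f = trans (zero-row u u∈ f w w∈ w∉) (sym (zero-row v v∈ (trans (sym (proj₁ (∷-inj e))) f) w w∈ w∉))

Lab₁-all : ∀ {R : Adj m} {U X} → U ⊆ X → Lab₁ R U X
Lab₁-all U⊆X = (λ _ → true) , (λ _ _ ()) , λ _ _ _ _ _ _ w w∈ w∉ → ⊥-elim (true≢false (U⊆X w w∈) w∉)

Lab₁-one : ∀ {R : Adj m} {U} → ∀ u X → (∀ z → z ∈ X → z ≡ u) → Lab₁ R U X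
Lab₁-one {R = R} u X uniq = (λ _ → true) , (λ _ _ ()) ,
  λ a b a∈ b∈ _ _ w _ _ → cong (λ z → R z w) (trans (uniq a a∈) (sym (uniq b b∈)))

module BlockGraphs (G : Graph) (chordal : Chordal G) where
  open Adjacency G
  open ChordalGraph G chordal
  open Separations G chordal

  private
    L : Sub (n G) → Sub (n G) → Set
    L = Lab₁ (E G)

  -- A set without `v` has a zero column at `w`; a set with `v` absorbs `w` as a zero row. This is
  -- the reason for working with `Lab₁`: with two arbitrary types, the zero row could become a
  -- third.
  pendant : ∀ {U v w} → v ∈ U → w ∈ U → v ≢ w → (∀ z → z ∈ U → w ~ z → z ≡ v) → W (L (U ─ w)) (U ─ w) → W (L U) U
  pendant {U} {v} {w} v∈ w∈ v≢w only t =
    W-cong (─-restore {U = U} w∈) (λ _ → Lab₁-all λ _ → id)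
      (W-insert Lab₁-one (∉─ {U = U}) lift ext (∈─ {X = U} v∈ v≢w) t)
    where
    away : ∀ {u} → u ∈ U → u ≢ v → w ≁ u
    away u∈ u≢v = ¬-not λ p → u≢v (only _ u∈ p)
    lift : ∀ Y → Y ⊆ U ─ w → v ∉ Y → L (U ─ w) Y → L U Y
    lift Y Y⊆ v∉ (ℓ , p , q) = ℓ , p' , q'
      where
      off : ∀ {u} → u ∈ Y → u ≁ w
      off u∈ = ≁-sym (away (proj₁ (∈─-elim {X = U} (Y⊆ _ u∈))) λ { refl → true≢false u∈ v∉ })
      p' : ∀ u → u ∈ Y → ℓ u ≡ false → ∀ z → z ∈ U → z ∉ Y → u ≁ z
      p' u u∈ e z z∈ z∉ with z ≟ w
      ... | yes refl = off u∈
      ... | no z≢w  = p u u∈ e z (∈─ {X = U} z∈ z≢w) z∉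
      q' : ∀ u u' → u ∈ Y → u' ∈ Y → ℓ u ≡ true → ℓ u' ≡ true → ∀ z → z ∈ U → z ∉ Y → E G u z ≡ E G u' z
      q' u u' u∈ u'∈ e e' z z∈ z∉ with z ≟ w
      ... | yes refl = trans (off u∈) (sym (off u'∈))
      ... | no z≢w  = q u u' u∈ u'∈ e e' z (∈─ {X = U} z∈ z≢w) z∉
    ext : ∀ Y → Y ⊆ U ─ w → v ∈ Y → L (U ─ w) Y → L U (Y ∪ ⟨ w ⟩)
    ext Y Y⊆ v∈Y (ℓ , p , q) = ℓ' , p' , q'
      where
      ℓ' : V → Bool
      ℓ' u = ℓ u ∧ not (⟨ w ⟩ u)
      inY : ∀ {u} → u ∈ Y ∪ ⟨ w ⟩ → u ≢ w → u ∈ Y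
      inY {u} u∈ u≢w = [ id , (λ r → ⊥-elim (u≢w (⟨⟩-elim r))) ]′ (∨-elim {Y u} u∈)
      out : ∀ {z} → z ∉ Y ∪ ⟨ w ⟩ → z ∉ Y × z ≢ w
      out {z} z∉ = ¬-not (λ r → true≢false (∨-introˡ r) z∉) ,
        λ { refl → true≢false (∨-introʳ {Y z} (⟨⟩-self z)) z∉ }
      p' : ∀ u → u ∈ Y ∪ ⟨ w ⟩ → ℓ' u ≡ false → ∀ z → z ∈ U → z ∉ Y ∪ ⟨ w ⟩ → u ≁ z
      p' u u∈ e z z∈ z∉ with u ≟ w | inY u∈ | out z∉
      ... | yes refl | _ | z∉Y , z≢w = away z∈ λ { refl → true≢false v∈Y z∉Y }
      ... | no u≢w  | u∈Y | z∉Y , z≢w with dichotomy (ℓ u)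
      ...   | inj₂ f = p u (u∈Y u≢w) f z (∈─ {X = U} z∈ z≢w) z∉Y
      ...   | inj₁ r = ⊥-elim (true≢false (trans (cong (_∧ true) r) refl) e)
      q' : ∀ u u' → u ∈ Y ∪ ⟨ w ⟩ → u' ∈ Y ∪ ⟨ w ⟩ → ℓ' u ≡ true → ℓ' u' ≡ true →
           ∀ z → z ∈ U → z ∉ Y ∪ ⟨ w ⟩ → E G u z ≡ E G u' z
      q' u u' u∈ u'∈ e e' z z∈ z∉ with ∧-elim {ℓ u} e | ∧-elim {ℓ u'} e' | out z∉
      ... | ℓu , u≢w | ℓu' , u'≢w | z∉Y , z≢w =
        q u u' (inY u∈ (does-false-elim (u ≟ w) (not-true⇒ u≢w))) (inY u'∈ (does-false-elim (u' ≟ w) (not-true⇒ u'≢w)))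
          ℓu ℓu' z (∈─ {X = U} z∈ z≢w) z∉Y

  -- Only the two leaves separate `v` from `w`. In every other cut `w` copies the column of `v` or
  -- the row of `v`, so adjacent and non-adjacent twins are treated alike.
  twin : ∀ {U v w} → v ∈ U → w ∈ U → v ≢ w → (∀ z → z ∈ U → z ≢ v → z ≢ w → E G w z ≡ E G v z) →
    W (L (U ─ w)) (U ─ w) → W (L U) U
  twin {U} {v} {w} v∈ w∈ v≢w tw t =
    W-cong (─-restore {U = U} w∈) (λ _ → Lab₁-all λ _ → id)
      (W-insert Lab₁-one (∉─ {U = U}) lift ext v∈' t)
    where
    v∈' : v ∈ U ─ w
    v∈' = ∈─ {X = U} v∈ v≢w
    lift : ∀ Y → Y ⊆ U ─ w → v ∉ Y → L (U ─ w) Y → L U Y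
    lift Y Y⊆ v∉ (ℓ , p , q) = ℓ , p' , q'
      where
      to-v : ∀ {u} → u ∈ Y → E G u w ≡ E G u v
      to-v {u} u∈ with ∈─-elim {X = U} (Y⊆ u u∈)
      ... | u∈U , u≢w = trans (E-sym G u w) (trans (tw u u∈U (λ { refl → true≢false u∈ v∉ }) u≢w) (E-sym G v u))
      p' : ∀ u → u ∈ Y → ℓ u ≡ false → ∀ z → z ∈ U → z ∉ Y → u ≁ z
      p' u u∈ e z z∈ z∉ with z ≟ w
      ... | yes refl = trans (to-v u∈) (p u u∈ e v v∈' v∉)
      ... | no z≢w  = p u u∈ e z (∈─ {X = U} z∈ z≢w) z∉
      q' : ∀ u u' → u ∈ Y → u' ∈ Y → ℓ u ≡ true → ℓ u' ≡ true → ∀ z → z ∈ U → z ∉ Y → E G u z ≡ E G u' z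
      q' u u' u∈ u'∈ e e' z z∈ z∉ with z ≟ w
      ... | yes refl = trans (to-v u∈) (trans (q u u' u∈ u'∈ e e' v v∈' v∉) (sym (to-v u'∈)))
      ... | no z≢w  = q u u' u∈ u'∈ e e' z (∈─ {X = U} z∈ z≢w) z∉
    ext : ∀ Y → Y ⊆ U ─ w → v ∈ Y → L (U ─ w) Y → L U (Y ∪ ⟨ w ⟩)
    ext Y Y⊆ v∈Y (ℓ , p , q) = ℓ ∘ proj₁ ∘ rep , p' , q'
      where
      rep : ∀ u → ∃[ u' ] (u ∈ Y ∪ ⟨ w ⟩ → u' ∈ Y × (∀ z → z ∈ U → z ∉ Y → z ≢ w → E G u z ≡ E G u' z))
      rep u with u ≟ w
      ... | yes refl = v , λ _ → v∈Y , λ z z∈ z∉ → tw z z∈ (λ { refl → true≢false v∈Y z∉ })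
      ... | no _     = u , λ u∈ → [ id , (λ ()) ]′ (∨-elim {Y u} u∈) , λ _ _ _ _ → refl
      out : ∀ {z} → z ∉ Y ∪ ⟨ w ⟩ → z ∉ Y × z ≢ w
      out {z} z∉ = ¬-not (λ r → true≢false (∨-introˡ r) z∉) ,
        λ { refl → true≢false (∨-introʳ {Y z} (⟨⟩-self z)) z∉ }
      p' : ∀ u → u ∈ Y ∪ ⟨ w ⟩ → ℓ (proj₁ (rep u)) ≡ false → ∀ z → z ∈ U → z ∉ Y ∪ ⟨ w ⟩ → u ≁ z
      p' u u∈ e z z∈ z∉ with proj₂ (rep u) u∈ | out z∉
      ... | r∈ , r | z∉Y , z≢w = trans (r z z∈ z∉Y z≢w) (p _ r∈ e z (∈─ {X = U} z∈ z≢w) z∉Y)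
      q' : ∀ u u' → u ∈ Y ∪ ⟨ w ⟩ → u' ∈ Y ∪ ⟨ w ⟩ → ℓ (proj₁ (rep u)) ≡ true → ℓ (proj₁ (rep u')) ≡ true →
           ∀ z → z ∈ U → z ∉ Y ∪ ⟨ w ⟩ → E G u z ≡ E G u' z
      q' u u' u∈ u'∈ e e' z z∈ z∉ with proj₂ (rep u) u∈ | proj₂ (rep u') u'∈ | out z∉
      ... | r∈ , r | r'∈ , r' | z∉Y , z≢w =
        trans (r z z∈ z∉Y z≢w) (trans (q _ _ r∈ r'∈ e e' z (∈─ {X = U} z∈ z≢w) z∉Y) (sym (r' z z∈ z∉Y z≢w)))

  -- If D is not a clique, it is separated into `X`, `F` and N. With N empty, D is a disjoint union.
  -- Otherwise some `v` in N is complete to `F`. A neighbour `c` of `c₀` in `F` is then a twin of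
  -- `c₀`: a vertex of `F` seeing only one of the two would form a diamond with them and `v`.
  -- Without such a `c`, the vertex `c₀` is pendant at `v`.
  block-tree : ∀ D → DiamondFree D → W (L D) D
  block-tree D = go D (<-wellFounded _)
    where
    go : ∀ D → Acc _<_ (count D) → DiamondFree D → W (L D) D
    go D (acc rs) df = start (any? λ v → ≡true? (D v))
      where
      less : ∀ {w} → w ∈ D → W (L (D ─ w)) (D ─ w)
      less w∈ = go _ (rs (count-─ D w∈)) (DiamondFree-⊆ (λ _ → proj₁ ∘ ∈─-elim {X = D}) df)
      separated : ∀ {a} → Separation D a → W (L D) D
      separated {a} sep = cases (any? λ v → ≡true? (D v) ×-dec ≡false? (X v) ×-dec ≡false? (F v))
        where
        open Separation sep
        part : ∀ {Y Z} → (∀ u z → u ∈ Y → z ∈ Z → u ≁ z) → (∀ z → z ∈ D → z ∈ Y ⊎ z ∈ Z) →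
          W (L Y) Y → W (L D) Y
        part {Y} {Z} none cover = W-map λ { A A⊆ (ℓ , p , q) → ℓ
          , (λ u u∈ e w w∈ w∉ → [ (λ w∈Y → p u u∈ e w w∈Y w∉) , none u w (A⊆ u u∈) ]′ (cover w w∈))
          , (λ u v u∈ v∈ e e' w w∈ w∉ → [ (λ w∈Y → q u v u∈ v∈ e e' w w∈Y w∉)
              , (λ w∈Z → trans (none u w (A⊆ u u∈) w∈Z) (sym (none v w (A⊆ v v∈) w∈Z))) ]′ (cover w w∈)) }
        cases : Dec (∃[ v ] v ∈ D × v ∉ X × v ∉ F) → W (L D) D
        cases (no empty) = node (Lab₁-all λ _ → id)
          (part (λ u z u∈ z∈ → F≁X u∈ z∈) cover
            (go F (rs (count-⊂ F D F⊆U a (X⊆U a a∈X) (¬-not λ p → true≢false a∈X (F∩X p)))) (DiamondFree-⊆ F⊆U df)))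
          (part (λ u z u∈ z∈ → ≁-sym (F≁X z∈ u∈)) (λ z z∈ → [ inj₂ , inj₁ ]′ (cover z z∈))
            (go X (rs (count-⊂ X D X⊆U c₀ (F⊆U c₀ c₀∈F) (F∩X c₀∈F))) (DiamondFree-⊆ X⊆U df)))
          (λ v → bool-ext (λ v∈ → [ ∨-introˡ , ∨-introʳ {F v} ]′ (cover v v∈))
                          (λ p → [ F⊆U v , X⊆U v ]′ (∨-elim {F v} p)))
          (λ v v∈F v∈X → true≢false v∈X (F∩X v∈F))
          where
          cover : ∀ v → v ∈ D → v ∈ F ⊎ v ∈ X
          cover v v∈ with dichotomy (F v) | dichotomy (X v)
          ... | inj₁ p | _ = inj₁ p
          ... | inj₂ _ | inj₁ p = inj₂ p
          ... | inj₂ v∉F | inj₂ v∉X = ⊥-elim (empty (v , v∈ , v∉X , v∉F))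
        cases (yes (v , v∈ , v∉X , v∉F)) = inner (any? λ c → ≡true? (F c) ×-dec ≡true? (E G c₀ c))
          where
          inner : Dec (∃[ c ] c ∈ F × c₀ ~ c) → W (L D) D
          inner (yes (c , c∈ , c₀~c)) = twin (F⊆U _ c₀∈F) (F⊆U c c∈) (~⇒≢ c₀~c)
            (λ z z∈ z≢c₀ z≢c → bool-ext (transfer c∈ c₀∈F (~-sym c₀~c) z∈ z≢c₀)
              (transfer c₀∈F c∈ c₀~c z∈ z≢c)) (less (F⊆U c c∈))
            where
            transfer : ∀ {c d z} → c ∈ F → d ∈ F → c ~ d → z ∈ D → z ≢ d → c ~ z → d ~ z
            transfer {c} {d} {z} c∈ d∈ c~d z∈ z≢d c~z with F-neighbour c∈ z∈ c~z
            ... | inj₂ (z∉X , z∉F) = ~-sym (N~F z∈ z∉X z∉F d∈)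
            ... | inj₁ z∈F with dichotomy (E G d z)
            ...   | inj₁ p = p
            ...   | inj₂ d≁z = ⊥-elim (df d z c v (F⊆U d d∈) z∈ (F⊆U c c∈) v∈ (λ e → z≢d (sym e)) d≁z
                      (~-sym (N~F v∈ v∉X v∉F c∈)) (~-sym c~d) (~-sym (N~F v∈ v∉X v∉F d∈))
                      (~-sym c~z) (~-sym (N~F v∈ v∉X v∉F z∈F)))
          inner (no lonely) = pendant v∈ (F⊆U _ c₀∈F) (λ { refl → true≢false c₀∈F v∉F }) only (less (F⊆U _ c₀∈F))
            where
            -- A second vertex `z` of N would give a path from a neighbour `x` of `v` in `X` through
            -- `z` to `c₀` that avoids `v`. By `neighbours-linked` the vertices `x` and `c₀` would
            -- be equal or adjacent, but `F` and `X` are disjoint and anticomplete.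
            only : ∀ z → z ∈ D → c₀ ~ z → z ≡ v
            only z z∈ c₀~z with F-neighbour c₀∈F z∈ c₀~z | z ≟ v
            ... | inj₁ z∈F | _ = ⊥-elim (lonely (z , z∈F , c₀~z))
            ... | inj₂ _ | yes e = e
            ... | inj₂ (z∉X , z∉F) | no z≢v with N~X v∈ v∉X v∉F | N~X z∈ z∉X z∉F
            ...   | x , x∈ , x~v | x' , x'∈ , x'~z =
              ⊥-elim ([ (λ { refl → true≢false x∈ (F∩X c₀∈F) }) , (λ p → true≢false (~-sym p) (F≁X c₀∈F x∈)) ]′
                (neighbours-linked df v∈ (X⊆U x x∈) (F⊆U _ c₀∈F) (~-sym x~v) (N~F v∈ v∉X v∉F c₀∈F)
                  (Walk⇒Path-end (Walk-++ (Walk-map (λ w∈ → X⊆U _ w∈ , λ { refl → true≢false w∈ v∉X })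
                      (Walk-++ (Walk-rev (X-conn x x∈)) (X-conn x' x'∈)))
                    (step (X⊆U x' x'∈ , λ { refl → true≢false x'∈ v∉X }) x'~z (stop (z∈ , z≢v)))) (~-sym c₀~z))))
      start : Dec (∃[ v ] v ∈ D) → W (L D) D
      start (no empty) = nil λ v → ¬-not λ v∈ → empty (v , v∈)
      start (yes (a , a∈)) with clique? D
      ... | inj₂ (u , v , u∈ , v∈ , u≢v , u≁v) = separated (separate D u∈ v∈ u≢v u≁v)
      ... | inj₁ cl with any? (λ w → ≡true? (D w) ×-dec ¬? (w ≟ a))
      ...   | yes (w , w∈ , w≢a) = twin a∈ w∈ (λ e → w≢a (sym e))
              (λ z z∈ z≢a z≢w → trans (cl w z w∈ z∈ (λ e → z≢w (sym e))) (sym (cl a z a∈ z∈ (λ e → z≢a (sym e))))) (less w∈)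
      ...   | no alone = leaf (Lab₁-all λ _ → id) a a∈ only
        where
        only : ∀ u → u ∈ D → u ≡ a
        only u u∈ with u ≟ a
        ... | yes e = e
        ... | no ne = ⊥-elim (alone (u , u∈ , ne))

  block-width : ∀ D → DiamondFree D → Width 1 (E G) D
  block-width D df = W-map (λ _ _ → Lab₁⇒Lab) (block-tree D df)

  -- Two cliques: a simplicial vertex q or one of its neighbours b of the other colour
  -- is either complete or anticomplete to each colour class.
  two-cliques-width : ∀ U (c : V → Bool) → (∀ u v → u ∈ U → v ∈ U → c u ≡ c v → u ≢ v → u ~ v) → Width 1 (E G) U
  two-cliques-width U c = λ cl → W-map (λ Y _ l → (λ v → c v ∷ []) ,
      λ u v u∈ v∈ e → l u v u∈ v∈ (proj₁ (∷-inj e))) (go U (<-wellFounded _) cl)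
    where
    Col : Sub (n G) → Sub (n G) → Set
    Col U X = ∀ u v → u ∈ X → v ∈ X → c u ≡ c v → ∀ w → w ∈ U → w ∉ X → E G u w ≡ E G v w
    opposite : ∀ {x y z : Bool} → x ≢ y → z ≢ x → z ≡ y
    opposite {true}  {true}  p q = ⊥-elim (p refl)
    opposite {false} {false} p q = ⊥-elim (p refl)
    opposite {true}  {false} p q = ¬-not q
    opposite {false} {true} {true} p q = refl
    opposite {false} {true} {false} p q = ⊥-elim (q refl)
    go : ∀ U → Acc _<_ (count U) → (∀ u v → u ∈ U → v ∈ U → c u ≡ c v → u ≢ v → u ~ v) → W (Col U) U
    go U (acc rs) cl = start (any? λ v → ≡true? (U v))
      where
      add : ∀ w → w ∈ U → (∀ u v → u ∈ U → v ∈ U → u ≢ w → v ≢ w → c u ≡ c v → E G u w ≡ E G v w) → W (Col U) U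
      add w w∈ hom = W-add w∈ (λ _ _ _ _ _ z z∈ z∉ → ⊥-elim (true≢false z∈ z∉))
        (λ u v u∈ v∈ _ z _ _ → cong (λ a → E G a z) (trans (⟨⟩-elim u∈) (sym (⟨⟩-elim v∈))))
        (W-map lift (go (U ─ w) (rs (count-─ U w∈)) (λ u v u∈ v∈ → cl u v (sub u∈) (sub v∈))))
        where
        sub : ∀ {u} → u ∈ U ─ w → u ∈ U
        sub = proj₁ ∘ ∈─-elim {X = U}
        lift : ∀ Y → Y ⊆ U ─ w → Col (U ─ w) Y → Col U Y
        lift Y Y⊆ l u v u∈ v∈ e z z∈ z∉ with z ≟ w
        ... | no z≢w = l u v u∈ v∈ e z (∈─ {X = U} z∈ z≢w) z∉
        ... | yes refl with ∈─-elim {X = U} (Y⊆ u u∈) | ∈─-elim {X = U} (Y⊆ v v∈)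
        ...   | u∈U , u≢w | v∈U , v≢w = hom u v u∈U v∈U u≢w v≢w e
      start : Dec (∃[ v ] v ∈ U) → W (Col U) U
      start (no empty) = nil λ v → ¬-not λ v∈ → empty (v , v∈)
      start (yes (a , a∈)) with simplicial-exists U a∈
      ... | q , q∈ , simp with any? (λ b → ≡true? (U b) ×-dec ¬? (c b ≟ᵇ c q) ×-dec ≡true? (E G q b))
      ...   | yes (b , b∈ , cb≢cq , q~b) = add b b∈ λ u v u∈ v∈ u≢b v≢b _ → trans (dom u u∈ u≢b) (sym (dom v v∈ v≢b))
        where
        -- Vertices of the colour of `b` are adjacent to it by `cl`. The others have the colour of
        -- `q`, hence are `q` itself or neighbours of `q`, and `q` is simplicial.
        dom : ∀ u → u ∈ U → u ≢ b → u ~ b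
        dom u u∈ u≢b with c u ≟ᵇ c b | u ≟ q
        ... | yes e | _ = cl u b u∈ b∈ e u≢b
        ... | no _ | yes refl = q~b
        ... | no cu≢cb | no u≢q = simp u b u∈ b∈ (cl q u q∈ u∈ (sym (opposite cb≢cq cu≢cb)) (λ e → u≢q (sym e))) q~b u≢b
      ...   | no none = add q q∈ hom
        where
        hom : ∀ u v → u ∈ U → v ∈ U → u ≢ q → v ≢ q → c u ≡ c v → E G u q ≡ E G v q
        hom u v u∈ v∈ u≢q v≢q e with c u ≟ᵇ c q
        ... | yes cu≡cq = trans (cl u q u∈ q∈ cu≡cq u≢q) (sym (cl v q v∈ q∈ (trans (sym e) cu≡cq) v≢q))
        ... | no cu≢cq = trans (off u u∈ cu≢cq) (sym (off v v∈ (λ e' → cu≢cq (trans e e'))))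
          where
          off : ∀ u → u ∈ U → c u ≢ c q → u ≁ q
          off u u∈ ne = ≁-sym (¬-not λ p → none (u , u∈ , ne , p))

-- A clique A and a diamond-free part in which every vertex misses at most one vertex of A

-- The default `d` stands in when nothing satisfies `P`. It gives the deletion lists a fixed length,
-- and deleting an arbitrary vertex does no harm.
at-most-one : ∀ {P : Fin m → Set} → Decidable P → (∀ x y → P x → P y → x ≡ y) → Fin m → ∃[ x ] ∀ y → P y → y ≡ x
at-most-one P? uniq d with any? P?
... | yes (x , px) = x , λ y py → uniq y x py px
... | no none      = d , λ y py → ⊥-elim (none (y , py))

module CliqueAndBlocks (G : Graph) (chordal : Chordal G) (free : Free P1+diamond G) where
  open Adjacency G
  open ChordalGraph G chordal
  open Separations G chordal
  open BlockGraphs G chordal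

  no-P₁+diamond : ∀ {x a b c d} → a ≢ b → a ≁ b → c ~ d → a ~ c → a ~ d → b ~ c → b ~ d →
    x ≢ a → x ≢ b → x ≢ c → x ≢ d → x ≁ a → x ≁ b → x ≁ c → x ≁ d → ⊥
  no-P₁+diamond {x} {a} {b} {c} {d} a≢b a≁b cd ac ad bc bd x≢a x≢b x≢c x≢d x≁a x≁b x≁c x≁d =
    free (f , (λ {i} {j} → inj i j) , eq)
    where
    -- The order is that of `P1+diamond`: under complementation the two isolated vertices of 2P₁ +
    -- P₂ become the adjacent pair `c`, `d`, and its edge becomes the non-edge between `a` and `b`.
    f : Fin 5 → V
    f zero                            = x
    f (suc zero)                      = c
    f (suc (suc zero))                = d
    f (suc (suc (suc zero)))          = a
    f (suc (suc (suc (suc zero))))    = b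
    inj : ∀ i j → f i ≡ f j → i ≡ j
    inj zero zero e = refl
    inj zero (suc zero) e = ⊥-elim (x≢c e)
    inj zero (suc (suc zero)) e = ⊥-elim (x≢d e)
    inj zero (suc (suc (suc zero))) e = ⊥-elim (x≢a e)
    inj zero (suc (suc (suc (suc zero)))) e = ⊥-elim (x≢b e)
    inj (suc zero) zero e = ⊥-elim (x≢c (sym e))
    inj (suc zero) (suc zero) e = refl
    inj (suc zero) (suc (suc zero)) e = ⊥-elim (~⇒≢ cd e)
    inj (suc zero) (suc (suc (suc zero))) e = ⊥-elim (~⇒≢ ac (sym e))
    inj (suc zero) (suc (suc (suc (suc zero)))) e = ⊥-elim (~⇒≢ bc (sym e))
    inj (suc (suc zero)) zero e = ⊥-elim (x≢d (sym e))
    inj (suc (suc zero)) (suc zero) e = ⊥-elim (~⇒≢ cd (sym e))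
    inj (suc (suc zero)) (suc (suc zero)) e = refl
    inj (suc (suc zero)) (suc (suc (suc zero))) e = ⊥-elim (~⇒≢ ad (sym e))
    inj (suc (suc zero)) (suc (suc (suc (suc zero)))) e = ⊥-elim (~⇒≢ bd (sym e))
    inj (suc (suc (suc zero))) zero e = ⊥-elim (x≢a (sym e))
    inj (suc (suc (suc zero))) (suc zero) e = ⊥-elim (~⇒≢ ac e)
    inj (suc (suc (suc zero))) (suc (suc zero)) e = ⊥-elim (~⇒≢ ad e)
    inj (suc (suc (suc zero))) (suc (suc (suc zero))) e = refl
    inj (suc (suc (suc zero))) (suc (suc (suc (suc zero)))) e = ⊥-elim (a≢b e)
    inj (suc (suc (suc (suc zero)))) zero e = ⊥-elim (x≢b (sym e))
    inj (suc (suc (suc (suc zero)))) (suc zero) e = ⊥-elim (~⇒≢ bc e)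
    inj (suc (suc (suc (suc zero)))) (suc (suc zero)) e = ⊥-elim (~⇒≢ bd e)
    inj (suc (suc (suc (suc zero)))) (suc (suc (suc zero))) e = ⊥-elim (a≢b (sym e))
    inj (suc (suc (suc (suc zero)))) (suc (suc (suc (suc zero)))) e = refl
    eq : ∀ i j → E G (f i) (f j) ≡ E P1+diamond i j
    eq zero zero = E-irr G x
    eq zero (suc zero) = x≁c
    eq zero (suc (suc zero)) = x≁d
    eq zero (suc (suc (suc zero))) = x≁a
    eq zero (suc (suc (suc (suc zero)))) = x≁b
    eq (suc zero) zero = ≁-sym x≁c
    eq (suc zero) (suc zero) = E-irr G c
    eq (suc zero) (suc (suc zero)) = cd
    eq (suc zero) (suc (suc (suc zero))) = ~-sym ac
    eq (suc zero) (suc (suc (suc (suc zero)))) = ~-sym bc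
    eq (suc (suc zero)) zero = ≁-sym x≁d
    eq (suc (suc zero)) (suc zero) = ~-sym cd
    eq (suc (suc zero)) (suc (suc zero)) = E-irr G d
    eq (suc (suc zero)) (suc (suc (suc zero))) = ~-sym ad
    eq (suc (suc zero)) (suc (suc (suc (suc zero)))) = ~-sym bd
    eq (suc (suc (suc zero))) zero = ≁-sym x≁a
    eq (suc (suc (suc zero))) (suc zero) = ac
    eq (suc (suc (suc zero))) (suc (suc zero)) = ad
    eq (suc (suc (suc zero))) (suc (suc (suc zero))) = E-irr G a
    eq (suc (suc (suc zero))) (suc (suc (suc (suc zero)))) = a≁b
    eq (suc (suc (suc (suc zero)))) zero = ≁-sym x≁b
    eq (suc (suc (suc (suc zero)))) (suc zero) = bc
    eq (suc (suc (suc (suc zero)))) (suc (suc zero)) = bd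
    eq (suc (suc (suc (suc zero)))) (suc (suc (suc zero))) = ≁-sym a≁b
    eq (suc (suc (suc (suc zero)))) (suc (suc (suc (suc zero)))) = E-irr G b

  -- Complementing around the clique

  Disjoint : Sub (n G) → Sub (n G) → Set
  Disjoint A B = ∀ v → v ∈ A → v ∈ B → ⊥

  -- Walks stand for components of `B`. The trivial walk, with `v` equal to `v'`, makes this at
  -- least as strong as `MissOne`.
  Linked : Sub (n G) → Sub (n G) → Set
  Linked A B = ∀ v v' s s' → v ∈ B → v' ∈ B → s ∈ A → s' ∈ A → v ≁ s → v' ≁ s' → Walk (_∈ B) v v' → s ≡ s'

  -- Complementing the edges inside A and between A and the rest isolates from each other
  -- the vertices of A, each together with the components containing its non-neighbours.
  module Split (A : Sub (n G)) where

    flip : Adj (n G)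
    flip u v = if A u ∨ A v then not (E G u v) else E G u v

    flip-sym : ∀ u v → flip u v ≡ flip v u
    flip-sym u v = cong₂ (λ a b → if a then not b else b) (∨-comm (A u) (A v)) (E-sym G u v)

    flip-A : ∀ {u v} → u ∈ A → u ~ v → flip u v ≡ false
    flip-A u∈ p rewrite u∈ | p = refl

    flip-B : ∀ {u v} → u ∉ A → v ∉ A → flip u v ≡ E G u v
    flip-B u∉ v∉ rewrite u∉ | v∉ = refl

    split-width : ∀ A' B' → A' ⊆ A → Disjoint A B' → Clique A' → DiamondFree B' → Linked A' B' →
      Width 2 flip (A' ∪ B')
    split-width A' = go A' (<-wellFounded _)
      where
      go : ∀ A' → Acc _<_ (count A') → ∀ B' → A' ⊆ A → Disjoint A B' → Clique A' → DiamondFree B' →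
        Linked A' B' → Width 2 flip (A' ∪ B')
      go A' (acc rs) B' A'⊆A disj cl df linked = start (any? λ v → ≡true? (A' v))
        where
        ∉A : ∀ {v} → v ∈ B' → v ∉ A
        ∉A v∈ = ¬-not λ p → disj _ p v∈
        on-B : ∀ X → X ⊆ B' → Width 1 flip X
        on-B X X⊆ = Width-ext (λ u v u∈ v∈ → sym (flip-B (∉A (X⊆ u u∈)) (∉A (X⊆ v v∈))))
          (block-width X (DiamondFree-⊆ X⊆ df))
        start : Dec (∃[ s ] s ∈ A') → Width 2 flip (A' ∪ B')
        start (no empty) = Width-cong (λ v → cong (_∨ B' v) (sym (¬-not λ p → empty (v , p))))
          (Width-suc (on-B B' λ _ → id))
        start (yes (s , s∈)) = around (grow next base init)
          where
          -- `s` is split off together with all components of `B'` that contain one of its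
          -- non-neighbours; `grow` closes `base` to the union of these components.
          base : Sub (n G)
          base v = B' v ∧ not (E G v s)
          Reached Closed : Sub (n G) → Set
          Reached X = X ⊆ B' × base ⊆ X × (∀ v → v ∈ X → ∃[ u ] u ∈ B' × u ≁ s × Walk (_∈ B') u v)
          Closed X = ∀ u v → u ∈ X → v ∈ B' → u ~ v → v ∈ X
          init : Reached base
          init = (λ v p → proj₁ (∧-elim {B' v} p)) , (λ _ → id) ,
            λ v p → let q , r = ∧-elim {B' v} p in v , q , not-true⇒ r , stop q
          next : ∀ X → Reached X → Closed X ⊎ ∃[ Y ] Reached Y × X ⊆ Y × ∃[ v ] v ∈ Y × v ∉ X
          next X (X⊆ , base⊆ , walks) with any? (λ u → any? λ v →
              ≡true? (X u) ×-dec ≡true? (B' v) ×-dec ≡true? (E G u v) ×-dec ≡false? (X v))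
          ... | no none = inj₁ λ u v u∈ v∈ p → [ id , (λ v∉ → ⊥-elim (none (u , v , u∈ , v∈ , p , v∉))) ]′ (dichotomy (X v))
          ... | yes (u , v , u∈ , v∈ , p , v∉) = inj₂ (X ∪ ⟨ v ⟩ ,
                ( (λ z z∈ → [ X⊆ z , (λ e → subst (_∈ B') (sym (⟨⟩-elim e)) v∈) ]′ (∨-elim {X z} z∈))
                , (λ z z∈ → ∨-introˡ (base⊆ z z∈))
                , (λ z z∈ → [ walks z , (λ e → subst (λ z → ∃[ u ] u ∈ B' × u ≁ s × Walk (_∈ B') u z) (sym (⟨⟩-elim e)) reach) ]′ (∨-elim {X z} z∈)))
                , (λ _ → ∨-introˡ) , v , ∨-introʳ {X v} (⟨⟩-self v) , v∉)
            where
            reach : ∃[ u ] u ∈ B' × u ≁ s × Walk (_∈ B') u v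
            reach with walks u u∈
            ... | u₀ , u₀∈ , u₀≁s , w = u₀ , u₀∈ , u₀≁s , Walk-++ w (step (X⊆ u u∈) p (stop v∈))
          around : (∃[ X ] Reached X × Closed X) → Width 2 flip (A' ∪ B')
          around (X , (X⊆ , base⊆ , walks) , closed) =
            Width-union cover disjoint apart (λ u v u∈ v∈ → trans (flip-sym u v) (apart v u v∈ u∈)) left right
            where
            Rest : Sub (n G)
            Rest v = B' v ∧ not (X v)
            Rest⊆ : Rest ⊆ B'
            Rest⊆ v p = proj₁ (∧-elim {B' v} p)
            Rest∉ : ∀ {v} → v ∈ Rest → v ∉ X
            Rest∉ {v} p = not-true⇒ (proj₂ (∧-elim {B' v} p))
            -- The bit for `s` is paid inside this piece alone. Since disjoint unions are free, the
            -- bound does not grow along the recursion over `A'`.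
            left : Width 2 flip (⟨ s ⟩ ∪ X)
            left = Width-delete s (Width-cong eq (on-B X X⊆))
              where
              eq : ∀ v → X v ≡ ((⟨ s ⟩ ∪ X) ─ s) v
              eq v with v ≟ s
              ... | yes refl = ¬-not λ p → disj s (A'⊆A s s∈) (X⊆ s p)
              ... | no _ with X v
              ...   | true  = refl
              ...   | false = refl
            A'─s⊆ : (A' ─ s) ⊆ A'
            A'─s⊆ _ = proj₁ ∘ ∈─-elim {X = A'}
            right : Width 2 flip ((A' ─ s) ∪ Rest)
            right = go (A' ─ s) (rs (count-─ A' s∈)) Rest (λ v p → A'⊆A v (A'─s⊆ v p))
              (λ v a b → disj v a (Rest⊆ v b)) (λ u v u∈ v∈ → cl u v (A'─s⊆ u u∈) (A'─s⊆ v v∈))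
              (DiamondFree-⊆ Rest⊆ df)
              λ v v' t t' v∈ v'∈ t∈ t'∈ p q w → linked v v' t t' (Rest⊆ v v∈) (Rest⊆ v' v'∈)
                (A'─s⊆ t t∈) (A'─s⊆ t' t'∈) p q (Walk-map (Rest⊆ _) w)
            cover : ∀ v → (A' ∪ B') v ≡ (⟨ s ⟩ ∪ X) v ∨ ((A' ─ s) ∪ Rest) v
            cover v = bool-ext to from
              where
              to : v ∈ A' ∪ B' → (⟨ s ⟩ ∪ X) v ∨ ((A' ─ s) ∪ Rest) v ≡ true
              to p with ∨-elim {A' v} p
              ... | inj₁ a with v ≟ s
              ...   | yes _ = refl
              ...   | no _  = ∨-introʳ {X v} (∨-introˡ (∧-intro a refl))
              to p | inj₂ b with dichotomy (X v)
              ...   | inj₁ x = ∨-introˡ (∨-introʳ {⟨ s ⟩ v} x)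
              ...   | inj₂ x = ∨-introʳ {(⟨ s ⟩ ∪ X) v} (∨-introʳ {(A' ─ s) v} (∧-intro b (cong not x)))
              from : (⟨ s ⟩ ∪ X) v ∨ ((A' ─ s) ∪ Rest) v ≡ true → v ∈ A' ∪ B'
              from p with ∨-elim {(⟨ s ⟩ ∪ X) v} p
              ... | inj₁ l = [ (λ e → ∨-introˡ (subst (_∈ A') (sym (⟨⟩-elim e)) s∈))
                             , (λ x → ∨-introʳ {A' v} (X⊆ v x)) ]′ (∨-elim {⟨ s ⟩ v} l)
              ... | inj₂ r = [ (λ a → ∨-introˡ (A'─s⊆ v a)) , (λ b → ∨-introʳ {A' v} (Rest⊆ v b)) ]′ (∨-elim {(A' ─ s) v} r)
            disjoint : Disjoint (⟨ s ⟩ ∪ X) ((A' ─ s) ∪ Rest)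
            disjoint v p q with ∨-elim {⟨ s ⟩ v} p | ∨-elim {(A' ─ s) v} q
            ... | inj₁ e | inj₁ a = proj₂ (∈─-elim {X = A'} a) (⟨⟩-elim e)
            ... | inj₁ e | inj₂ b = disj s (A'⊆A s s∈) (subst (_∈ B') (⟨⟩-elim e) (Rest⊆ v b))
            ... | inj₂ x | inj₁ a = disj v (A'⊆A v (A'─s⊆ v a)) (X⊆ v x)
            ... | inj₂ x | inj₂ b = true≢false x (Rest∉ b)
            apart : ∀ u v → u ∈ ⟨ s ⟩ ∪ X → v ∈ (A' ─ s) ∪ Rest → flip u v ≡ false
            apart u v p q with ∨-elim {⟨ s ⟩ u} p | ∨-elim {(A' ─ s) v} q
            ... | inj₁ e | inj₁ a = trans (cong (λ z → flip z v) (⟨⟩-elim e)) (flip-A (A'⊆A s s∈)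
                  (cl s v s∈ (A'─s⊆ v a) λ e → proj₂ (∈─-elim {X = A'} a) (sym e)))
            ... | inj₁ e | inj₂ b = trans (cong (λ z → flip z v) (⟨⟩-elim e)) (flip-A (A'⊆A s s∈)
                  ([ ~-sym , (λ v≁s → ⊥-elim (true≢false (base⊆ v (∧-intro (Rest⊆ v b) (cong not v≁s))) (Rest∉ b))) ]′
                    (dichotomy (E G v s))))
            ... | inj₂ x | inj₁ a = trans (flip-sym u v) (flip-A (A'⊆A v (A'─s⊆ v a))
                  ([ ~-sym , (λ u≁v → ⊥-elim (other u≁v (walks u x))) ]′ (dichotomy (E G u v))))
              where
              other : u ≁ v → (∃[ u₀ ] u₀ ∈ B' × u₀ ≁ s × Walk (_∈ B') u₀ u) → ⊥
              other u≁v (u₀ , u₀∈ , u₀≁s , w) = proj₂ (∈─-elim {X = A'} a)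
                (sym (linked u₀ u s v u₀∈ (X⊆ u x) s∈ (A'─s⊆ v a) u₀≁s u≁v w))
            ... | inj₂ x | inj₂ b = trans (flip-B (∉A (X⊆ u x)) (∉A (Rest⊆ v b)))
                  (¬-not λ p → true≢false (closed u v x (Rest⊆ v b) p) (Rest∉ b))

  -- Whether `flip` complements a pair depends only on which of its ends lie in `A`, so a third bit,
  -- membership in `A`, recovers the original edges.
  linked-width : ∀ A B → Disjoint A B → Clique A → DiamondFree B → Linked A B → Width 3 (E G) (A ∪ B)
  linked-width A B disj cl df linked = Width-color A unflip (split-width A B (λ _ → id) disj cl df linked)
    where
    open Split A
    not-inj : ∀ {a b} → not a ≡ not b → a ≡ b
    not-inj {true}  {true}  _ = refl
    not-inj {false} {false} _ = refl
    unflip : ∀ u v w → u ≢ w → v ≢ w → u ∈ A ∪ B → v ∈ A ∪ B → w ∈ A ∪ B → A u ≡ A v →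
      flip u w ≡ flip v w → E G u w ≡ E G v w
    unflip u v w _ _ _ _ _ e p rewrite e with A v ∨ A w
    ... | true  = not-inj p
    ... | false = p

  MissOne : Sub (n G) → Sub (n G) → Set
  MissOne A B = ∀ v s s' → v ∈ B → s ∈ A → s' ∈ A → v ≁ s → v ≁ s' → s ≡ s'

  module _ {A B : Sub (n G)} (disj : Disjoint A B) (cl : Clique A) (df : DiamondFree B) (miss : MissOne A B) where

    -- If adjacent `v` and `v'` missed different vertices `s` and `s'`, each would see the vertex
    -- missed by the other, and `v`, `v'`, `s`, `s'` would be an induced 4-cycle.
    close-misses : ∀ {v v' s s'} → v ∈ B → v' ∈ B → s ∈ A → s' ∈ A → v ≁ s → v' ≁ s' →
      v ≡ v' ⊎ v ~ v' → s ≡ s'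
    close-misses v∈ _ s∈ s'∈ p q (inj₁ refl) = miss _ _ _ v∈ s∈ s'∈ p q
    close-misses {v} {v'} {s} {s'} v∈ v'∈ s∈ s'∈ p q (inj₂ v~v') with s ≟ s'
    ... | yes e   = e
    ... | no s≢s' = ⊥-elim (no-C₄ v~v' v'~s (cl s s' s∈ s'∈ s≢s') (~-sym v~s')
                      (λ { refl → disj v s∈ v∈ }) (λ { refl → disj v' s'∈ v'∈ }) p q)
      where
      v'~s : v' ~ s
      v'~s = [ id , (λ f → ⊥-elim (s≢s' (miss v' s s' v'∈ s∈ s'∈ f q))) ]′ (dichotomy (E G v' s))
      v~s' : v ~ s'
      v~s' = [ id , (λ f → ⊥-elim (s≢s' (miss v s s' v∈ s∈ s'∈ p f))) ]′ (dichotomy (E G v s'))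

    -- With all p's complete to the remaining A, every vertex missing some s ∈ A has a
    -- neighbour among the p's, since s, p₀, p₁, p₂ form a diamond.
    module WithP₃ {p₀ p₁ p₂ : V} (p₀∈ : p₀ ∈ B) (p₁∈ : p₁ ∈ B) (p₂∈ : p₂ ∈ B)
      (p₀~p₁ : p₀ ~ p₁) (p₁~p₂ : p₁ ~ p₂) (p₀≢p₂ : p₀ ≢ p₂) (p₀≁p₂ : p₀ ≁ p₂) where

      missed : ∀ p → p ∈ B → ∃[ s ] ∀ s' → s' ∈ A × p ≁ s' → s' ≡ s
      missed p p∈ = at-most-one (λ s → ≡true? (A s) ×-dec ≡false? (E G p s))
        (λ { s s' (s∈ , r) (s'∈ , r') → miss p s s' p∈ s∈ s'∈ r r' }) p₀

      deleted : List V
      deleted = p₀ ∷ p₁ ∷ p₂ ∷ proj₁ (missed p₀ p₀∈) ∷ proj₁ (missed p₁ p₁∈) ∷ proj₁ (missed p₂ p₂∈) ∷ []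

      A' B' : Sub (n G)
      A' = A ∖ deleted
      B' = B ∖ deleted

      complete : ∀ {s p} (p∈ : p ∈ B) → proj₁ (missed p p∈) ∈ₗ deleted → s ∈ A' → p ~ s
      complete {s} {p} p∈ i s∈ with ∈∖-elim {X = A} deleted s∈ | dichotomy (E G p s)
      ... | _ | inj₁ r = r
      ... | s∈A , ne | inj₂ r = ⊥-elim (ne _ i (proj₂ (missed p p∈) s (s∈A , r)))

      touch : ∀ {v s} → v ∈ B' → s ∈ A' → v ≁ s → p₀ ~ v ⊎ p₁ ~ v ⊎ p₂ ~ v
      touch {v} {s} v∈ s∈ v≁s with dichotomy (E G p₀ v) | dichotomy (E G p₁ v) | dichotomy (E G p₂ v)
      ... | inj₁ p | _ | _ = inj₁ p
      ... | inj₂ _ | inj₁ p | _ = inj₂ (inj₁ p)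
      ... | inj₂ _ | inj₂ _ | inj₁ p = inj₂ (inj₂ p)
      ... | inj₂ n₀ | inj₂ n₁ | inj₂ n₂ with ∈∖-elim {X = B} deleted v∈ | ∈∖-elim {X = A} deleted s∈
      ...   | v∈B , ne | s∈A , _ = ⊥-elim (no-P₁+diamond p₀≢p₂ p₀≁p₂
              (complete p₁∈ (there (there (there (there (here refl))))) s∈) p₀~p₁
              (complete p₀∈ (there (there (there (here refl)))) s∈) (~-sym p₁~p₂)
              (complete p₂∈ (there (there (there (there (there (here refl)))))) s∈)
              (ne _ (here refl)) (ne _ (there (there (here refl)))) (ne _ (there (here refl)))
              (λ { refl → disj v s∈A v∈B }) (≁-sym n₀) (≁-sym n₂) (≁-sym n₁) v≁s)

      Avoid : V → V → Set
      Avoid p v = v ∈ B × v ≢ p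

      -- `v` and `p'` are neighbours of `p` joined by a walk that avoids `p`, so `neighbours-linked`
      -- applies. It carries the contact of `v` from one vertex of the path to the next, until both
      -- ends of the walk touch the same one.
      pull : ∀ {p p' v z} → p ∈ B → p' ∈ B → p ~ p' → v ∈ B → v ≢ p' → p ~ v → Walk (Avoid p) v z → z ~ p' → p' ~ v
      pull p∈ p'∈ p~p' v∈ v≢p' p~v w z~p' with neighbours-linked df p∈ v∈ p'∈ p~v p~p' (Walk⇒Path-end w z~p')
      ... | inj₁ e = ⊥-elim (v≢p' e)
      ... | inj₂ r = ~-sym r

      linked : Linked A' B'
      linked v v' s s' v∈ v'∈ s∈ s'∈ v≁s v'≁s' w with ∈∖-elim {X = B} deleted v∈ | ∈∖-elim {X = B} deleted v'∈
      ... | v∈B , ne | v'∈B , ne' = cases (touch v∈ s∈ v≁s) (touch v'∈ s'∈ v'≁s')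
        where
        avoid : ∀ {p} → p ∈ₗ deleted → Walk (Avoid p) v v'
        avoid i = Walk-map (λ z∈ → let z∈B , z≢ = ∈∖-elim {X = B} deleted z∈ in z∈B , z≢ _ i) w
        i₀ : p₀ ∈ₗ deleted
        i₀ = here refl
        i₁ : p₁ ∈ₗ deleted
        i₁ = there (here refl)
        i₂ : p₂ ∈ₗ deleted
        i₂ = there (there (here refl))
        common : ∀ {p} → p ∈ B → p ∈ₗ deleted → p ~ v → p ~ v' → s ≡ s'
        common p∈ i pv pv' = close-misses v∈B v'∈B (proj₁ (∈∖-elim {X = A} deleted s∈))
          (proj₁ (∈∖-elim {X = A} deleted s'∈)) v≁s v'≁s'
          ([ inj₁ , (λ path → neighbours-linked df p∈ v∈B v'∈B pv pv' path) ]′ (Walk⇒≡⊎Path (avoid i)))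
        adjacent : ∀ {p p'} → p ∈ B → p' ∈ B → p ∈ₗ deleted → p' ∈ₗ deleted → p ~ p' → p ~ v → p' ~ v' → s ≡ s'
        adjacent p∈ p'∈ i i' p~p' pv p'v' =
          common p'∈ i' (pull p∈ p'∈ p~p' v∈B (ne _ i') pv (avoid i) (~-sym p'v')) p'v'
        -- The walk is prolonged from `v'` through `p'`, a neighbour of `p₁`, and still avoids `p`.
        -- This moves the contact of `v` to `p₁`, after which `adjacent` finishes.
        opposite : ∀ {p p'} → p ∈ B → p' ∈ B → p ∈ₗ deleted → p' ∈ₗ deleted → p ~ p₁ → p₁ ~ p' → p ≢ p' →
          p ~ v → p' ~ v' → s ≡ s'
        opposite p∈ p'∈ i i' p~p₁ p₁~p' p≢p' pv p'v' = adjacent p₁∈ p'∈ i₁ i' p₁~p'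
          (pull p∈ p₁∈ p~p₁ v∈B (ne _ i₁) pv
            (Walk-++ (avoid i) (step (v'∈B , ne' _ i) (~-sym p'v') (stop (p'∈ , λ e → p≢p' (sym e))))) (~-sym p₁~p')) p'v'
        cases : p₀ ~ v ⊎ p₁ ~ v ⊎ p₂ ~ v → p₀ ~ v' ⊎ p₁ ~ v' ⊎ p₂ ~ v' → s ≡ s'
        cases (inj₁ a) (inj₁ b) = common p₀∈ i₀ a b
        cases (inj₁ a) (inj₂ (inj₁ b)) = adjacent p₀∈ p₁∈ i₀ i₁ p₀~p₁ a b
        cases (inj₁ a) (inj₂ (inj₂ b)) = opposite p₀∈ p₂∈ i₀ i₂ p₀~p₁ p₁~p₂ p₀≢p₂ a b
        cases (inj₂ (inj₁ a)) (inj₁ b) = adjacent p₁∈ p₀∈ i₁ i₀ (~-sym p₀~p₁) a b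
        cases (inj₂ (inj₁ a)) (inj₂ (inj₁ b)) = common p₁∈ i₁ a b
        cases (inj₂ (inj₁ a)) (inj₂ (inj₂ b)) = adjacent p₁∈ p₂∈ i₁ i₂ p₁~p₂ a b
        cases (inj₂ (inj₂ a)) (inj₁ b) = opposite p₂∈ p₀∈ i₂ i₀ (~-sym p₁~p₂) (~-sym p₀~p₁) (λ e → p₀≢p₂ (sym e)) a b
        cases (inj₂ (inj₂ a)) (inj₂ (inj₁ b)) = adjacent p₂∈ p₁∈ i₂ i₁ (~-sym p₁~p₂) a b
        cases (inj₂ (inj₂ a)) (inj₂ (inj₂ b)) = common p₂∈ i₂ a b

      width : Width 9 (E G) (A ∪ B)
      width = Width-deletes deleted (Width-cong (∖-∪ A B deleted) (linked-width A' B' disj' cl' (DiamondFree-⊆ B'⊆B df) linked))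
        where
        A'⊆A : A' ⊆ A
        A'⊆A v p = proj₁ (∈∖-elim {X = A} deleted p)
        B'⊆B : B' ⊆ B
        B'⊆B v p = proj₁ (∈∖-elim {X = B} deleted p)
        disj' : Disjoint A' B'
        disj' v a b = disj v (A'⊆A v a) (B'⊆B v b)
        cl' : Clique A'
        cl' u v u∈ v∈ = cl u v (A'⊆A u u∈) (A'⊆A v v∈)

    -- If `B` has no induced path on three vertices, its components are cliques and `close-misses`
    -- already gives `Linked`. Otherwise the three vertices of such a path and the at most three
    -- vertices of `A` that they miss are the six deletions.
    clique-and-blocks-width : Width 9 (E G) (A ∪ B)
    clique-and-blocks-width with any? (λ p₀ → any? λ p₁ → any? λ p₂ →
        ≡true? (B p₀) ×-dec ≡true? (B p₁) ×-dec ≡true? (B p₂) ×-dec ≡true? (E G p₀ p₁) ×-dec ≡true? (E G p₁ p₂) ×-dec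
        ¬? (p₀ ≟ p₂) ×-dec ≡false? (E G p₀ p₂))
    ... | yes (p₀ , p₁ , p₂ , p₀∈ , p₁∈ , p₂∈ , e₁ , e₂ , ne , r) = WithP₃.width p₀∈ p₁∈ p₂∈ e₁ e₂ ne r
    ... | no none = Width-+ 6 (linked-width A B disj cl df λ v v' s s' v∈ v'∈ s∈ s'∈ p q w →
            close-misses v∈ v'∈ s∈ s'∈ p q (adjacent w))
      where
      adjacent : ∀ {a b} → Walk (_∈ B) a b → a ≡ b ⊎ a ~ b
      adjacent (stop _) = inj₁ refl
      adjacent {a} {b} (step {b = c} a∈ p w) with adjacent w
      ... | inj₁ refl = inj₂ p
      ... | inj₂ q with a ≟ b | dichotomy (E G a b)
      ...   | yes e  | _      = inj₁ e
      ...   | no _   | inj₁ r = inj₂ r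
      ...   | no a≢b | inj₂ r = ⊥-elim (none (a , c , b , a∈ , Walk-start w , Walk-start (Walk-rev w) , p , q , a≢b , r))

-- The two simplicial vertices

module Theorem (G : Graph) (chordal : Chordal G) (free : Free P1+diamond G) where
  open Adjacency G
  open ChordalGraph G chordal
  open Separations G chordal
  open BlockGraphs G chordal
  open CliqueAndBlocks G chordal free

  ⊤ₛ : Sub (n G)
  ⊤ₛ _ = true

  Near : V → V → Set
  Near a x = x ≡ a ⊎ a ~ x

  near? : ∀ a x → Dec (Near a x)
  near? a x = (x ≟ a) ⊎-dec ≡true? (E G a x)

  near-clique : ∀ {a u v} → Simplicial ⊤ₛ a → Near a u → Near a v → u ≢ v → u ~ v
  near-clique s (inj₁ refl) (inj₁ refl) u≢v = ⊥-elim (u≢v refl)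
  near-clique s (inj₁ refl) (inj₂ q) _ = q
  near-clique s (inj₂ p) (inj₁ refl) _ = ~-sym p
  near-clique (_ , s) (inj₂ p) (inj₂ q) u≢v = s _ _ refl refl p q u≢v

  Only : V → V → V → Set
  Only a b x = Near a x × x ≢ b × b ≁ x

  only? : ∀ a b x → Dec (Only a b x)
  only? a b x = near? a x ×-dec ¬? (x ≟ b) ×-dec ≡false? (E G b x)

  Neither : V → V → V → Set
  Neither a b w = (w ≢ a × a ≁ w) × (w ≢ b × b ≁ w)

  not-near : ∀ {a x} → x ≢ a → a ≁ x → ¬ Near a x
  not-near x≢a _ (inj₁ e)  = x≢a e
  not-near _ a≁x (inj₂ p) = true≢false p a≁x

  module Side {a b : V} (sa : Simplicial ⊤ₛ a) (a≢b : a ≢ b) (a≁b : a ≁ b) where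

    -- Two such neighbours would form a diamond with the non-adjacent pair `a`, `w`, and `b` is
    -- isolated from it.
    single-neighbour : ∀ {w x x'} → Neither a b w → Only a b x → Only a b x' → w ~ x → w ~ x' → x ≡ x'
    single-neighbour {w} {x} {x'} ((w≢a , a≁w) , (w≢b , b≁w)) (inj₁ refl , _) _ w~x _ = ⊥-elim (true≢false (~-sym w~x) a≁w)
    single-neighbour {w} {x} {x'} ((w≢a , a≁w) , (w≢b , b≁w)) (inj₂ _ , _) (inj₁ refl , _) _ w~x' = ⊥-elim (true≢false (~-sym w~x') a≁w)
    single-neighbour {w} {x} {x'} ((w≢a , a≁w) , (w≢b , b≁w)) (inj₂ a~x , x≢b , b≁x) (inj₂ a~x' , x'≢b , b≁x') w~x w~x'
      with x ≟ x'
    ... | yes e = e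
    ... | no x≢x' = ⊥-elim (no-P₁+diamond {x = b} (λ e → w≢a (sym e)) a≁w (near-clique sa (inj₂ a~x) (inj₂ a~x') x≢x')
          a~x a~x' w~x w~x' (λ e → a≢b (sym e)) (λ e → w≢b (sym e)) (λ e → x≢b (sym e)) (λ e → x'≢b (sym e))
          (≁-sym a≁b) b≁w b≁x b≁x')

    -- Here the diamond consists of the non-adjacent pair `a`, `y` and the adjacent pair `x`, `x'`;
    -- the isolated vertex is `w`.
    single-cross : ∀ {w x x' y} → Neither a b w → Only a b x → Only a b x' → Only b a y →
      w ≁ x → w ≁ x' → w ≁ y → x ~ y → x' ~ y → x ≡ x'
    single-cross _ (inj₁ refl , _) _ (_ , _ , a≁y) _ _ _ x~y _ = ⊥-elim (true≢false x~y a≁y)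
    single-cross _ (inj₂ _ , _) (inj₁ refl , _) (_ , _ , a≁y) _ _ _ _ x'~y = ⊥-elim (true≢false x'~y a≁y)
    single-cross {w} {x} {x'} {y} ((w≢a , a≁w) , (w≢b , b≁w)) (inj₂ a~x , _) (inj₂ a~x' , _) (near-y , y≢a , a≁y)
      w≁x w≁x' w≁y x~y x'~y with x ≟ x'
    ... | yes e = e
    ... | no x≢x' = ⊥-elim (no-P₁+diamond {x = w} (λ e → y≢a (sym e)) a≁y (near-clique sa (inj₂ a~x) (inj₂ a~x') x≢x')
          a~x a~x' (~-sym x~y) (~-sym x'~y) w≢a
          (λ { refl → not-near w≢b b≁w near-y })
          (λ { refl → true≢false a~x a≁w }) (λ { refl → true≢false a~x' a≁w })
          (≁-sym a≁w) w≁y w≁x w≁x')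

  module TwoSimplicial {q q' : V} (sq : Simplicial ⊤ₛ q) (sq' : Simplicial ⊤ₛ q') (q≢q' : q ≢ q') (q≁q' : q ≁ q') where

    module Left  = Side sq q≢q' q≁q'
    module Right = Side sq' (λ e → q≢q' (sym e)) (≁-sym q≁q')

    K K' M : V → Set
    K  = Only q q'
    K' = Only q' q
    M  = Neither q q'

    swap : ∀ {w} → M w → Neither q' q w
    swap (p , p') = p' , p

    K∩K' : ∀ {x y} → K x → K' y → x ≢ y
    K∩K' (near , _) (_ , y≢q , q≁y) refl = not-near y≢q q≁y near

    A B : Sub (n G)
    A v = E G q v ∧ E G q' v
    B v = not (A v)

    A-clique : Clique A
    A-clique u v u∈ v∈ = near-clique sq (inj₂ (proj₁ (∧-elim {E G q u} u∈))) (inj₂ (proj₁ (∧-elim {E G q v} v∈)))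

    classify : ∀ {v} → v ∈ B → K v ⊎ K' v ⊎ M v
    classify {v} v∈ with near? q v | near? q' v
    ... | yes (inj₁ refl) | _ = inj₁ (inj₁ refl , q≢q' , ≁-sym q≁q')
    ... | no _ | yes (inj₁ refl) = inj₂ (inj₁ (inj₁ refl , (λ e → q≢q' (sym e)) , q≁q'))
    ... | yes (inj₂ p) | yes (inj₁ refl) = ⊥-elim (true≢false p q≁q')
    ... | yes (inj₂ p) | yes (inj₂ p') = ⊥-elim (true≢false (∧-intro p p') (not-true⇒ v∈))
    ... | yes (inj₂ p) | no far = inj₁ (inj₂ p , (λ e → far (inj₁ e)) , ¬-not λ r → far (inj₂ r))
    ... | no far | yes (inj₂ p) = inj₂ (inj₁ (inj₂ p , (λ e → far (inj₁ e)) , ¬-not λ r → far (inj₂ r)))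
    ... | no far | no far' = inj₂ (inj₂ (((λ e → far (inj₁ e)) , ¬-not λ r → far (inj₂ r)) ,
                                         ((λ e → far' (inj₁ e)) , ¬-not λ r → far' (inj₂ r))))

    neither? : ∀ w → Dec (M w)
    neither? w = (¬? (w ≟ q) ×-dec ≡false? (E G q w)) ×-dec (¬? (w ≟ q') ×-dec ≡false? (E G q' w))

    chain-width : (∀ w → ¬ M w) → Width 1 (E G) ⊤ₛ
    chain-width none = two-cliques-width ⊤ₛ (λ v → does (near? q v)) cl
      where
      other : ∀ {v} → ¬ Near q v → Near q' v
      other {v} far with near? q' v
      ... | yes p = p
      ... | no far' = ⊥-elim (none v (((λ e → far (inj₁ e)) , ¬-not λ r → far (inj₂ r)) ,
                                      ((λ e → far' (inj₁ e)) , ¬-not λ r → far' (inj₂ r))))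
      cl : ∀ u v → u ∈ ⊤ₛ → v ∈ ⊤ₛ → does (near? q u) ≡ does (near? q v) → u ≢ v → u ~ v
      cl u v _ _ e u≢v with dichotomy (does (near? q u))
      ... | inj₁ t = near-clique sq (does-elim (near? q u) t) (does-elim (near? q v) (trans (sym e) t)) u≢v
      ... | inj₂ f = near-clique sq' (other (does-false-elim (near? q u) f))
                       (other (does-false-elim (near? q v) (trans (sym e) f))) u≢v

    -- Four deletions relative to a vertex w outside both neighbourhoods: its neighbours x₀ in K and
    -- y₀ in K', then the end x₁ in K of the only K–K' edge, and x₂ in K of the only
    -- connection K–M–K'.
    module WithOutside {w : V} (Mw : M w) where

      x₀-spec : ∃[ x ] ∀ y → K y × w ~ y → y ≡ x
      x₀-spec = at-most-one (λ x → only? q q' x ×-dec ≡true? (E G w x))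
        (λ { x y (kx , wx) (ky , wy) → Left.single-neighbour Mw kx ky wx wy }) q

      y₀-spec : ∃[ x ] ∀ y → K' y × w ~ y → y ≡ x
      y₀-spec = at-most-one (λ x → only? q' q x ×-dec ≡true? (E G w x))
        (λ { x y (kx , wx) (ky , wy) → Right.single-neighbour (swap Mw) kx ky wx wy }) q

      Cross : V → V → Set
      Cross x y = (K x × w ≁ x) × (K' y × w ≁ y) × x ~ y

      -- By `single-cross`, two such edges with different ends in `K` have no diagonal between them.
      -- Since both closed neighbourhoods are cliques, they would complete to an induced 4-cycle.
      cross-unique : ∀ {x y x' y'} → Cross x y → Cross x' y' → x ≡ x'
      cross-unique {x} {y} {x'} {y'} ((kx , wx) , (ky , wy) , xy) ((kx' , wx') , (ky' , wy') , xy') with x ≟ x'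
      ... | yes e = e
      ... | no x≢x' = ⊥-elim (no-C₄ xy y~y' (~-sym xy') (~-sym x~x')
            (K∩K' kx ky') (λ e → K∩K' kx' ky (sym e)) x≁y' y≁x')
        where
        x≁y' : x ≁ y'
        x≁y' = ¬-not λ p → x≢x' (Left.single-cross Mw kx kx' ky' wx wx' wy' p xy')
        y≁x' : y ≁ x'
        y≁x' = ¬-not λ p → x≢x' (Left.single-cross Mw kx kx' ky wx wx' wy xy (~-sym p))
        x~x' : x ~ x'
        x~x' = near-clique sq (proj₁ kx) (proj₁ kx') x≢x'
        y~y' : y ~ y'
        y~y' = near-clique sq' (proj₁ ky) (proj₁ ky') λ { refl → true≢false xy x≁y' }

      x₁-spec : ∃[ x ] ∀ x' → ∃ (Cross x') → x' ≡ x
      x₁-spec = at-most-one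
        (λ x → any? λ y → (only? q q' x ×-dec ≡false? (E G w x)) ×-dec (only? q' q y ×-dec ≡false? (E G w y)) ×-dec ≡true? (E G x y))
        (λ { x x' (y , c) (y' , c') → cross-unique c c' }) q

      x₀ y₀ x₁ : V
      x₀ = proj₁ x₀-spec
      y₀ = proj₁ y₀-spec
      x₁ = proj₁ x₁-spec

      w≁K : ∀ {x} → K x → x ≢ x₀ → w ≁ x
      w≁K kx ne = ¬-not λ p → ne (proj₂ x₀-spec _ (kx , p))

      w≁K' : ∀ {y} → K' y → y ≢ y₀ → w ≁ y
      w≁K' ky ne = ¬-not λ p → ne (proj₂ y₀-spec _ (ky , p))

      no-cross : ∀ {x y} → K x → x ≢ x₀ → x ≢ x₁ → K' y → y ≢ y₀ → x ≁ y
      no-cross {x} {y} kx x≢x₀ x≢x₁ ky y≢y₀ =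
        ¬-not λ p → x≢x₁ (proj₂ x₁-spec x (y , (kx , w≁K kx x≢x₀) , (ky , w≁K' ky y≢y₀) , p))

      Bridge : V → V → V → Set
      Bridge x a y = (K x × x ≢ x₀ × x ≢ x₁) × M a × (K' y × y ≢ y₀) × x ~ a × a ~ y

      -- If `x` and `x'` differ, `single-neighbour` makes `a` and `x'` non-adjacent neighbours of
      -- `x`. They are joined by a path through `K'` and `a'`, where `x` has no neighbour:
      -- `no-cross` covers `K'`, and `single-neighbour` covers `a'`.
      bridge-unique : ∀ {x a y x' a' y'} → Bridge x a y → Bridge x' a' y' → x ≡ x'
      bridge-unique {x} {a} {y} {x'} {a'} {y'} ((kx , x≢x₀ , x≢x₁) , ma , (ky , y≢y₀) , x~a , a~y)
                                               ((kx' , _) , ma' , (ky' , y'≢y₀) , x'~a' , a'~y') with x ≟ x'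
      ... | yes e = e
      ... | no x≢x' = ⊥-elim (no-cone {c = x} x~a x~x' (λ { refl → not-near (proj₁ (proj₁ ma)) (proj₂ (proj₁ ma)) (proj₁ kx') })
            a≁x' (step a~y (off-K' ky y≢y₀) tail))
        where
        x~x' : x ~ x'
        x~x' = near-clique sq (proj₁ kx) (proj₁ kx') x≢x'
        a≁x' : a ≁ x'
        a≁x' = ¬-not λ p → x≢x' (Left.single-neighbour ma kx kx' (~-sym x~a) p)
        x≁a' : x ≁ a'
        x≁a' = ¬-not λ p → x≢x' (Left.single-neighbour ma' kx kx' (~-sym p) (~-sym x'~a'))
        Off : V → Set
        Off v = v ≢ x × x ≁ v
        off-K' : ∀ {z} → K' z → z ≢ y₀ → Off z
        off-K' kz z≢y₀ = (λ e → K∩K' kx kz (sym e)) , no-cross kx x≢x₀ x≢x₁ kz z≢y₀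
        off-a' : Off a'
        off-a' = (λ { refl → not-near (proj₁ (proj₁ ma')) (proj₂ (proj₁ ma')) (proj₁ kx) }) , x≁a'
        tail : Path Off y x'
        tail with y ≟ y'
        ... | yes refl = step (~-sym a'~y') off-a' (edge (~-sym x'~a'))
        ... | no y≢y'  = step (near-clique sq' (proj₁ ky) (proj₁ ky') y≢y') (off-K' ky' y'≢y₀)
                           (step (~-sym a'~y') off-a' (edge (~-sym x'~a')))

      x₂-spec : ∃[ x ] ∀ x' → (∃[ a ] ∃[ y ] Bridge x' a y) → x' ≡ x
      x₂-spec = at-most-one
        (λ x → any? λ a → any? λ y → (only? q q' x ×-dec ¬? (x ≟ x₀) ×-dec ¬? (x ≟ x₁)) ×-dec neither? a ×-dec
          (only? q' q y ×-dec ¬? (y ≟ y₀)) ×-dec ≡true? (E G x a) ×-dec ≡true? (E G a y))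
        (λ { x x' (_ , _ , b) (_ , _ , b') → bridge-unique b b' }) q

      deleted : List V
      deleted = x₀ ∷ y₀ ∷ x₁ ∷ proj₁ x₂-spec ∷ []

      A₁ B₁ : Sub (n G)
      A₁ = A ∖ deleted
      B₁ = B ∖ deleted

      A₁⊆A : A₁ ⊆ A
      A₁⊆A v p = proj₁ (∈∖-elim {X = A} deleted p)

      B₁⊆B : B₁ ⊆ B
      B₁⊆B v p = proj₁ (∈∖-elim {X = B} deleted p)

      A∩B : ∀ {v s} → v ∈ B₁ → s ∈ A₁ → v ≢ s
      A∩B {v} v∈ s∈ refl = true≢false (A₁⊆A v s∈) (not-true⇒ (B₁⊆B v v∈))

      kept : ∀ {v} → v ∈ B₁ → ∀ x → x ∈ₗ deleted → v ≢ x
      kept v∈ = proj₂ (∈∖-elim {X = B} deleted v∈)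

      no-K-K' : ∀ {x y} → x ∈ B₁ → K x → y ∈ B₁ → K' y → x ≁ y
      no-K-K' x∈ kx y∈ ky = no-cross kx (kept x∈ _ (here refl)) (kept x∈ _ (there (there (here refl))))
        ky (kept y∈ _ (there (here refl)))

      no-K-K'-path : ∀ {x y z} → x ∈ B₁ → K x → y ∈ B₁ → K' y → z ∈ B₁ → x ~ z → z ~ y → ⊥
      no-K-K'-path {x} {y} {z} x∈ kx y∈ ky z∈ xz zy with classify (B₁⊆B z z∈)
      ... | inj₁ kz = true≢false zy (no-K-K' z∈ kz y∈ ky)
      ... | inj₂ (inj₁ kz) = true≢false xz (no-K-K' x∈ kx z∈ kz)
      ... | inj₂ (inj₂ mz) = kept x∈ _ (there (there (there (here refl))))
            (proj₂ x₂-spec x (z , y , (kx , kept x∈ _ (here refl) , kept x∈ _ (there (there (here refl)))) ,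
              mz , (ky , kept y∈ _ (there (here refl))) , xz , zy))

      -- A diamond that misses K is disjoint from and anticomplete to q; one that meets both
      -- K and K' contains a K–K' path of length at most two.
      diamond-free : DiamondFree B₁
      diamond-free a b c d a∈ b∈ c∈ d∈ a≢b a≁b cd ac ad bc bd = meets-both meets-K meets-K'
        where
        One : (V → Set) → Set
        One P = P a ⊎ P b ⊎ P c ⊎ P d
        meets : ∀ (z : V) {P : V → Set} → (∀ {v} → v ∈ B₁ → P v ⊎ (z ≢ v × z ≁ v)) → One P
        meets z f with f a∈ | f b∈ | f c∈ | f d∈
        ... | inj₁ p | _ | _ | _ = inj₁ p
        ... | inj₂ _ | inj₁ p | _ | _ = inj₂ (inj₁ p)
        ... | inj₂ _ | inj₂ _ | inj₁ p | _ = inj₂ (inj₂ (inj₁ p))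
        ... | inj₂ _ | inj₂ _ | inj₂ _ | inj₁ p = inj₂ (inj₂ (inj₂ p))
        ... | inj₂ (za , na) | inj₂ (zb , nb) | inj₂ (zc , nc) | inj₂ (zd , nd) =
          ⊥-elim (no-P₁+diamond {x = z} a≢b a≁b cd ac ad bc bd za zb zc zd na nb nc nd)
        meets-K : One K
        meets-K = meets q λ v∈ → [ inj₁ , [ (λ { (_ , v≢q , q≁v) → inj₂ ((λ e → v≢q (sym e)) , q≁v) })
          , (λ { ((v≢q , q≁v) , _) → inj₂ ((λ e → v≢q (sym e)) , q≁v) }) ]′ ]′ (classify (B₁⊆B _ v∈))
        meets-K' : One K'
        meets-K' = meets q' λ v∈ → [ (λ { (_ , v≢q , q≁v) → inj₂ ((λ e → v≢q (sym e)) , q≁v) }) , [ inj₁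
          , (λ { (_ , (v≢q , q≁v)) → inj₂ ((λ e → v≢q (sym e)) , q≁v) }) ]′ ]′ (classify (B₁⊆B _ v∈))
        adj⊥ : ∀ {x y} → x ∈ B₁ → y ∈ B₁ → x ~ y → K x → K' y → ⊥
        adj⊥ x∈ y∈ xy kx ky = true≢false xy (no-K-K' x∈ kx y∈ ky)
        meets-both : One K → One K' → ⊥
        meets-both (inj₁ p) (inj₁ r) = K∩K' p r refl
        meets-both (inj₁ p) (inj₂ (inj₁ r)) = no-K-K'-path a∈ p b∈ r c∈ ac (~-sym bc)
        meets-both (inj₁ p) (inj₂ (inj₂ (inj₁ r))) = adj⊥ a∈ c∈ ac p r
        meets-both (inj₁ p) (inj₂ (inj₂ (inj₂ r))) = adj⊥ a∈ d∈ ad p r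
        meets-both (inj₂ (inj₁ p)) (inj₁ r) = no-K-K'-path b∈ p a∈ r c∈ bc (~-sym ac)
        meets-both (inj₂ (inj₁ p)) (inj₂ (inj₁ r)) = K∩K' p r refl
        meets-both (inj₂ (inj₁ p)) (inj₂ (inj₂ (inj₁ r))) = adj⊥ b∈ c∈ bc p r
        meets-both (inj₂ (inj₁ p)) (inj₂ (inj₂ (inj₂ r))) = adj⊥ b∈ d∈ bd p r
        meets-both (inj₂ (inj₂ (inj₁ p))) (inj₁ r) = adj⊥ c∈ a∈ (~-sym ac) p r
        meets-both (inj₂ (inj₂ (inj₁ p))) (inj₂ (inj₁ r)) = adj⊥ c∈ b∈ (~-sym bc) p r
        meets-both (inj₂ (inj₂ (inj₁ p))) (inj₂ (inj₂ (inj₁ r))) = K∩K' p r refl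
        meets-both (inj₂ (inj₂ (inj₁ p))) (inj₂ (inj₂ (inj₂ r))) = adj⊥ c∈ d∈ cd p r
        meets-both (inj₂ (inj₂ (inj₂ p))) (inj₁ r) = adj⊥ d∈ a∈ (~-sym ad) p r
        meets-both (inj₂ (inj₂ (inj₂ p))) (inj₂ (inj₁ r)) = adj⊥ d∈ b∈ (~-sym bd) p r
        meets-both (inj₂ (inj₂ (inj₂ p))) (inj₂ (inj₂ (inj₁ r))) = adj⊥ d∈ c∈ (~-sym cd) p r
        meets-both (inj₂ (inj₂ (inj₂ p))) (inj₂ (inj₂ (inj₂ r))) = K∩K' p r refl

      -- Vertices of `K` and `K'` are complete to `A`, as `q` and `q'` are simplicial. A vertex of
      -- `M` missing `s` and `s'` would be isolated from the diamond on `q`, `q'`, `s`, `s'`.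
      miss-one : MissOne A₁ B₁
      miss-one v s s' v∈ s∈ s'∈ v≁s v≁s' with ∧-elim {E G q s} (A₁⊆A s s∈) | ∧-elim {E G q s'} (A₁⊆A s' s'∈)
                                            | classify (B₁⊆B v v∈) | s ≟ s'
      ... | _ | _ | _ | yes e = e
      ... | qs , _ | _ | inj₁ (near , _) | _ =
        ⊥-elim (true≢false (near-clique sq near (inj₂ qs) (A∩B v∈ s∈)) v≁s)
      ... | _ , q's | _ | inj₂ (inj₁ (near , _)) | _ =
        ⊥-elim (true≢false (near-clique sq' near (inj₂ q's) (A∩B v∈ s∈)) v≁s)
      ... | qs , q's | qs' , q's' | inj₂ (inj₂ ((v≢q , q≁v) , (v≢q' , q'≁v))) | no s≢s' =
        ⊥-elim (no-P₁+diamond q≢q' q≁q' (near-clique sq (inj₂ qs) (inj₂ qs') s≢s') qs qs' q's q's'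
          v≢q v≢q' (A∩B v∈ s∈) (A∩B v∈ s'∈) (≁-sym q≁v) (≁-sym q'≁v) v≁s v≁s')

      width : Width 13 (E G) ⊤ₛ
      width = Width-deletes deleted (Width-cong eq (clique-and-blocks-width (λ v v∈A v∈B → A∩B v∈B v∈A refl)
        (λ u v u∈ v∈ → A-clique u v (A₁⊆A u u∈) (A₁⊆A v v∈)) diamond-free miss-one))
        where
        eq : ∀ v → (A₁ ∪ B₁) v ≡ (⊤ₛ ∖ deleted) v
        eq v = bool-ext
          (λ p → [ (λ a → ∈∖ {X = ⊤ₛ} deleted refl (proj₂ (∈∖-elim {X = A} deleted a)))
                 , (λ b → ∈∖ {X = ⊤ₛ} deleted refl (proj₂ (∈∖-elim {X = B} deleted b))) ]′ (∨-elim {A₁ v} p))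
          (λ p → let ne = proj₂ (∈∖-elim {X = ⊤ₛ} deleted p) in
            [ (λ a → ∨-introˡ (∈∖ {X = A} deleted a ne))
            , (λ b → ∨-introʳ {A₁ v} (∈∖ {X = B} deleted (cong not b) ne)) ]′ (dichotomy (A v)))

    two-simplicial-width : Width 13 (E G) ⊤ₛ
    two-simplicial-width with any? neither?
    ... | yes (w , Mw) = WithOutside.width Mw
    ... | no none      = Width-+ 12 (chain-width λ w Mw → none (w , Mw))

  bounded-width : Width 13 (E G) ⊤ₛ
  bounded-width with clique? ⊤ₛ
  ... | inj₁ cl = Width-+ 12 (two-cliques-width ⊤ₛ (λ _ → true) λ u v u∈ v∈ _ → cl u v u∈ v∈)
  -- The lemma is applied twice: `u` is only a starting point for finding `q`, and `q'` is then
  -- found away from `q`.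
  ... | inj₂ (u , v , _ , _ , u≢v , u≁v) with simplicial-away ⊤ₛ refl refl u≢v u≁v
  ...   | q , sq , q≢u , u≁q with simplicial-away ⊤ₛ {q} {u} refl refl q≢u (≁-sym u≁q)
  ...     | q' , sq' , q'≢q , q≁q' = TwoSimplicial.two-simplicial-width sq sq' (λ e → q'≢q (sym e)) q≁q'

theorem5 : BoundedCW (λ G → Chordal G × Free P1+diamond G)
theorem5 = 3 * 2 ^ 13 , λ { G (chordal , free) 0<n → Width⇒CW G (λ _ → refl) 0<n (Theorem.bounded-width G chordal free) }
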